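{- Let $d\ge 1$ and $r_1,\dots,r_d\ge1$ be integers, and for $i=1,\dots,d$ let $w_i=z_{k_{i,1}}\cdots z_{k_{i,r_i}}$ with positive integers $k_{i,j}$. Then in $\mathcal{A}$, \begin{align*} &\sum_{i=1}^{d} Z_{\mathcal{A}}^{\mathrm{cyc}}\bigl(w_{1}\otimes\cdots\otimes w_{i-1}\otimes(y\,\widetilde{\sqcup\!\sqcup}\, w_{i})\otimes w_{i+1}\otimes\cdots\otimes w_{d}\bigr)\\ &=2\sum_{i=1}^{d}\sum_{j=1}^{r_i} Z_{\mathcal{A}}^{\mathrm{cyc}}\bigl(w_{1}\otimes\cdots\otimes w_{i-1}\otimes z_{k_{i,1}}\cdots z_{k_{i,j-1}}z_{k_{i,j}+1}z_{k_{i,j+1}}\cdots z_{k_{i,r_i}}\otimes w_{i+1}\otimes\cdots\otimes w_{d}\bigr). \end{align*}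
   Context: Let $\mathcal{A}=\bigl(\prod_p\mathbb{Z}/p\mathbb{Z}\bigr)/\bigl(\bigoplus_p\mathbb{Z}/p\mathbb{Z}\bigr)$, $p$ running over all primes. Let $\mathfrak{H}=\mathbb{Q}\langle x,y\rangle$ (noncommutative polynomials) and $z_k:=yx^{k-1}$ for $k\ge1$. The shuffle product $\sqcup\!\sqcup$ on $\mathfrak{H}$ is the $\mathbb{Q}$-bilinear product with $1\sqcup\!\sqcup w=w\sqcup\!\sqcup 1=w$ and $wu\sqcup\!\sqcup w'u'=(w\sqcup\!\sqcup w'u')u+(wu\sqcup\!\sqcup w')u'$ for words $w,w'$ and letters $u,u'\in\{x,y\}$. Define $y\,\widetilde{\sqcup\!\sqcup}\, z_k:=-y^2$ if $k=1$, $:=0$ if $k=2$, $:=yx(y\sqcup\!\sqcup x^{k-3})x$ if $k\ge3$, and extend by $y\,\widetilde{\sqcup\!\sqcup}\, z_{k_1}\cdots z_{k_r}:=\sum_{l=1}^r z_{k_1}\cdots z_{k_{l-1}}(y\,\widetilde{\sqcup\!\sqcup}\, z_{k_l})z_{k_{l+1}}\cdots z_{k_r}$ (and $\mathbb{Q}$-linearly). Let $\mathfrak{H}^{\mathrm{cyc}}$ be the subspace of $\bigoplus_{d\ge1}\mathfrak{H}^{\otimes d}$ spanned by $w_1\otimes\cdots\otimes w_d$ with all $w_i\in y\mathfrak{H}$ (every word in $y\mathfrak{H}$ is uniquely a product of $z_k$'s). For a multi-index $\boldsymbol{k}=[\boldsymbol{k}_1,\dots,\boldsymbol{k}_d]$,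 $\boldsymbol{k}_i=(k_{i,1},\dots,k_{i,r_i})\in\mathbb{Z}_{\ge1}^{r_i}$, $r=r_1+\cdots+r_d$, define $\zeta^{\mathrm{cyc}}_{\mathcal{A}}(\boldsymbol{k})=\bigl(\sum_{S_p}\prod_{i=1}^d\prod_{j=1}^{r_i}n_{i,j}^{ -k_{i,j}}\bmod p\bigr)_p\in\mathcal{A}$, where $S_p$ is the set of $(n_{1,1},\dots,n_{d,r_d})\in\{1,\dots,p-1\}^r$ with $n_{i,1}<\cdots<n_{i,r_i}$ for all $i$ and $n_{1,1}\le n_{2,r_2},\dots,n_{d-1,1}\le n_{d,r_d}$, $n_{d,1}\le n_{1,r_1}$. Define the $\mathbb{Q}$-linear map $Z^{\mathrm{cyc}}_{\mathcal{A}}:\mathfrak{H}^{\mathrm{cyc}}\to\mathcal{A}$ by $Z^{\mathrm{cyc}}_{\mathcal{A}}(z_{k_{1,1}}\cdots z_{k_{1,r_1}}\otimes\cdots\otimes z_{k_{d,1}}\cdots z_{k_{d,r_d}})=\zeta^{\mathrm{cyc}}_{\mathcal{A}}([(k_{1,1},\dots,k_{1,r_1}),\dots,(k_{d,1},\dots,k_{d,r_d})])$. -}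

module Defs where

open import Data.Nat as ℕ using (ℕ; zero; suc; _∸_; _<_; _≤?_; _≤ᵇ_)
open import Data.Integer as ℤ using (ℤ; +_)
open import Data.Rational as ℚ using (ℚ; 0ℚ; 1ℚ; ↥_)
open import Data.List using (List; []; _∷_; _++_; map; concat; concatMap; replicate; reverse; filter; upTo; length; zipWith; foldr; drop; [_])
open import Data.Product using (_×_; _,_; ∃)
open import Data.Bool using (Bool; true; false; _∧_)
open import Data.Nat.Divisibility using (_∣_)
open import Data.Nat.Primality using (Prime)

data Letter : Set where
  x y : Letter

Word : Set
Word = List Letter

-- formal ℚ-linear combinations
Lin : Set → Set
Lin A = List (ℚ × A)

z : ℕ → Word
z k = y ∷ replicate (k ∸ 1) x

zs : List ℕ → Word
zs = concatMap z

-- shuffle of words (recursion on first letters), list of resulting words (each coefficient 1)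
shuffleF : Word → Word → List Word
shuffleF [] v = [ v ]
shuffleF (a ∷ u) [] = [ a ∷ u ]
shuffleF (a ∷ u) (b ∷ v) = map (a ∷_) (shuffleF u (b ∷ v)) ++ map (b ∷_) (shuffleF (a ∷ u) v)

-- the shuffle as defined in the paper, by recursion on the LAST letters
shuffle : Word → Word → List Word
shuffle u v = map reverse (shuffleF (reverse u) (reverse v))

ytildeZ : ℕ → Lin Word
ytildeZ zero = []
ytildeZ (suc zero) = (ℚ.- 1ℚ , y ∷ y ∷ []) ∷ []
ytildeZ (suc (suc zero)) = []
ytildeZ (suc (suc (suc m))) = map (λ w → (1ℚ , y ∷ x ∷ (w ++ [ x ]))) (shuffle [ y ] (replicate m x))

ytilde : List ℕ → Lin Word
ytilde [] = []
ytilde (k ∷ ks) =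
  map (λ { (c , u) → (c , u ++ zs ks) }) (ytildeZ k)
  ++ map (λ { (c , u) → (c , z k ++ u) }) (ytilde ks)

incAll : List ℕ → Lin Word
incAll [] = []
incAll (k ∷ ks) = (1ℚ , zs (suc k ∷ ks)) ∷ map (λ { (c , u) → (c , z k ++ u) }) (incAll ks)

Tensor : Set
Tensor = List Word

sumSlots : (List ℕ → Lin Word) → List (List ℕ) → Lin Tensor
sumSlots f [] = []
sumSlots f (ks ∷ kss) =
  map (λ { (c , u) → (c , u ∷ map zs kss) }) (f ks)
  ++ map (λ { (c , t) → (c , zs ks ∷ t) }) (sumSlots f kss)

-- decompose a word y x^{a} y x^{b} ⋯ into (a+1, b+1, …); words in y𝔥 only matter
parseGo : ℕ → Word → List ℕ
parseGo k [] = [ k ]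
parseGo k (x ∷ w) = parseGo (suc k) w
parseGo k (y ∷ w) = k ∷ parseGo 1 w

parse : Word → List ℕ
parse [] = []
parse (x ∷ w) = parse w
parse (y ∷ w) = parseGo 1 w

incSeqs : ℕ → ℕ → ℕ → List (List ℕ)
incSeqs p zero lo = [ [] ]
incSeqs p (suc r) lo =
  concatMap (λ n → map (n ∷_) (incSeqs p r (suc n))) (filter (lo ≤?_) (drop 1 (upTo p)))

allTuples : ℕ → List ℕ → List (List (List ℕ))
allTuples p [] = [ [] ]
allTuples p (r ∷ rs) = concatMap (λ s → map (s ∷_) (allTuples p rs)) (incSeqs p r 1)

hd : List ℕ → ℕ
hd [] = 0
hd (a ∷ _) = a

lst : List ℕ → ℕ
lst [] = 0
lst (a ∷ []) = a
lst (_ ∷ b ∷ bs) = lst (b ∷ bs)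

rot : List (List ℕ) → List (List ℕ)
rot [] = []
rot (a ∷ as) = as ++ [ a ]

andAll : List Bool → Bool
andAll = foldr _∧_ true

cycOK : List (List ℕ) → Bool
cycOK ns = andAll (zipWith (λ a b → hd a ≤ᵇ lst b) ns (rot ns))

invN : ℕ → ℚ
invN zero = 0ℚ
invN (suc m) = + 1 ℚ./ suc m

powQ : ℚ → ℕ → ℚ
powQ q zero = 1ℚ
powQ q (suc k) = q ℚ.* powQ q k

prodQ : List ℚ → ℚ
prodQ = foldr ℚ._*_ 1ℚ

sumQ : List ℚ → ℚ
sumQ = foldr ℚ._+_ 0ℚ

weight : List (List ℕ) → List (List ℕ) → ℚ
weight kss nss = prodQ (zipWith (λ ks ns → prodQ (zipWith (λ k n → powQ (invN n) k) ks ns)) kss nss)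

-- p-component of ζ^cyc_𝒜(k), as a rational with denominator prime to p
zetaCycP : ℕ → List (List ℕ) → ℚ
zetaCycP p kss = sumQ (map (weight kss) (filter (λ ns → Data.Bool._≟_ (cycOK ns) true) (allTuples p (map length kss))))
  where import Data.Bool

ZcycP : ℕ → Lin Tensor → ℚ
ZcycP p L = sumQ (map (λ { (c , t) → c ℚ.* zetaCycP p (map parse t) }) L)

-- equality in 𝒜 of elements given by p-integral rational representatives
_≡𝒜_ : (ℕ → ℚ) → (ℕ → ℚ) → Set
a ≡𝒜 b = ∃ λ N → ∀ p → Prime p → N < p → p ∣ ℤ.∣ ↥ (a p ℚ.- b p) ∣

module Submission where

-- For l < m the sum of l⁻ⁱ m⁻ʲ over i + j = k + 1 is (l⁻ᵏ − m⁻ᵏ)/(m − l).  Hence replacing the letter of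
-- an index n by its image under y ⧢̃ amounts to inserting a new index m next to n, with weight
-- 1/(m − n) − 1/m above n and −1/(n − m) − 1/m below n.  In a gap between two consecutive indices the
-- terms in m − n cancel by reflection, which leaves −2 ∑ 1/m.  If a is the first index of a slot and b
-- the last index of the next slot, so that the cyclic condition reads a ≤ b, the insertions below a and
-- above b together give 2 ∑_{a ≤ m ≤ b} 1/m if a ≤ b and 0 otherwise, up to the error
-- H(p−1−b) − H(p−1) − H(b) = −∑_{m ≤ b} (1/m + 1/(p − m)), which is divisible by p.  The harmonic
-- numbers telescope around the cycle, and only 2 ∑ 1/n over the original indices n survives.

open import Defs
open import Data.Nat using (ℕ; _≤_)
open import Data.List using (List; [])
open import Data.List.Relation.Unary.All using (All)
open import Relation.Binary.PropositionalEquality using (_≢_)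
open import Data.Rational using (ℚ; _*_; 1ℚ; _+_)

open import Data.Bool as Bool using (true; false; if_then_else_; _∧_)
open import Data.Empty using (⊥-elim)
open import Data.Integer as ℤ using (ℤ)
import Data.Integer.Properties as ℤP
open import Data.List using (_∷_; _++_; map; concatMap; replicate; reverse; filter; applyUpTo; length; [_]; zipWith)
import Data.List.Properties as ListP
open import Data.List.Relation.Unary.All as All using ([]; _∷_)
import Data.List.Relation.Unary.All.Properties as AllP
open import Data.Maybe using (Maybe; just; nothing)
open import Data.Nat as ℕ using (zero; suc; _∸_; _<_; _≤ᵇ_; _<ᵇ_; z≤n; s≤s)
import Data.Nat.Properties as ℕP
open import Data.Nat.Divisibility using (_∣_; _∤_; ∣1⇒≡1; >⇒∤; m∣m*n; ∣m⇒∣m*n)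
open import Data.Nat.Primality using (Prime; euclidsLemma; ¬prime[1])
open import Data.Product using (_×_; _,_; proj₁; proj₂)
open import Data.Rational using (0ℚ; -_; _-_; ↥_; ↧_; ↧ₙ_; fromℚᵘ; toℚᵘ)
import Data.Rational.Properties as ℚP
open import Data.Rational.Unnormalised as ℚᵘ using (mkℚᵘ)
import Data.Rational.Unnormalised.Properties as ℚᵘP
open import Data.Sum using (inj₁; inj₂)
open import Data.Unit using (tt)
open import Function using (_∘_)
open import Level using (0ℓ)
open import Relation.Binary.PropositionalEquality
  using (_≡_; refl; sym; trans; cong; cong₂; subst; module ≡-Reasoning)
open import Relation.Nullary using (yes; no; does; Dec)
open import Tactic.RingSolver using (solve-∀)
open import Tactic.RingSolver.Core.AlmostCommutativeRing
  using (AlmostCommutativeRing; fromCommutativeRing)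

open ≡-Reasoning

-- The cyclic condition sees of each slot only its two end indices. Each slot is therefore a linear
-- functional applied to an arbitrary function of these two indices, and the condition enters late,
-- as one particular such function. The decomposition into the doubled sums and a remainder is exact
-- in ℚ for every upper bound `N`, with no prime involved. The obstacle lies at the ends of the
-- slots: an insertion beyond an end index has no partner in its own slot, and the condition then
-- applies to the inserted index. Its partner is the insertion at the facing end of the neighbouring
-- slot. The remainder is thus produced slot by slot (`moveAny`) but has to be regrouped by the
-- inequalities of the cycle (`movePath-∷`). After that it is divisible by p for each choice of end
-- indices separately, so no congruence between multiple sums is needed.

ℚ-ring : AlmostCommutativeRing 0ℓ 0ℓ
ℚ-ring = fromCommutativeRing ℚP.+-*-commutativeRing isZero
  where
  isZero : ∀ q → Maybe (0ℚ ≡ q)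
  isZero q with 0ℚ ℚP.≟ q
  ... | yes e = just e
  ... | no  _ = nothing

2ℚ : ℚ
2ℚ = 1ℚ + 1ℚ

-- Finite sums and linear functionals

∑ : ℕ → (ℕ → ℚ) → ℚ
∑ zero    f = 0ℚ
∑ (suc n) f = ∑ n f + f (suc n)

∑-cong : ∀ M {f g} → (∀ n → 1 ≤ n → n ≤ M → f n ≡ g n) → ∑ M f ≡ ∑ M g
∑-cong zero    e = refl
∑-cong (suc M) e =
  cong₂ _+_ (∑-cong M (λ n 1≤n n≤M → e n 1≤n (ℕP.m≤n⇒m≤1+n n≤M))) (e (suc M) (s≤s z≤n) ℕP.≤-refl)

-- All iterated sums below are functionals of a test function, and these three laws suffice to
-- interchange them with finite sums and formal combinations (`comm-∑`, `comm-⟪⟫`). `ext` is a field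
-- because pointwise equal functions need not be provably equal.
record Linear {A : Set} (Λ : (A → ℚ) → ℚ) : Set where
  field
    ext   : ∀ {f g} → (∀ a → f a ≡ g a) → Λ f ≡ Λ g
    add   : ∀ f g → Λ (λ a → f a + g a) ≡ Λ f + Λ g
    scale : ∀ r f → Λ (λ a → r * f a) ≡ r * Λ f

  scaleʳ : ∀ f r → Λ (λ a → f a * r) ≡ Λ f * r
  scaleʳ f r = trans (ext (λ a → ℚP.*-comm (f a) r)) (trans (scale r f) (ℚP.*-comm r (Λ f)))

  zer : Λ (λ _ → 0ℚ) ≡ 0ℚ
  zer = trans (scale 0ℚ (λ _ → 0ℚ)) (ℚP.*-zeroˡ (Λ (λ _ → 0ℚ)))

  sub : ∀ f g → Λ (λ a → f a - g a) ≡ Λ f - Λ g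
  sub f g = begin
    Λ (λ a → f a - g a)               ≡⟨ ext (λ a → minus (f a) (g a)) ⟩
    Λ (λ a → f a + (- 1ℚ) * g a)      ≡⟨ add f _ ⟩
    Λ f + Λ (λ a → (- 1ℚ) * g a)      ≡⟨ cong (Λ f +_) (scale (- 1ℚ) g) ⟩
    Λ f + (- 1ℚ) * Λ g                ≡⟨ sym (minus (Λ f) (Λ g)) ⟩
    Λ f - Λ g                         ∎
    where
    minus : ∀ a b → a - b ≡ a + (- 1ℚ) * b
    minus = solve-∀ ℚ-ring

  comm-∑ : ∀ M (f : ℕ → A → ℚ) → Λ (λ a → ∑ M (λ n → f n a)) ≡ ∑ M (λ n → Λ (f n))
  comm-∑ zero    f = zer
  comm-∑ (suc M) f = trans (add _ _) (cong (_+ Λ (f (suc M))) (comm-∑ M f))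

open Linear

*-zeroˡ-≡ : ∀ {a} b → a ≡ 0ℚ → a * b ≡ 0ℚ
*-zeroˡ-≡ b refl = ℚP.*-zeroˡ b

*-identityˡ-≡ : ∀ {a} b → a ≡ 1ℚ → a * b ≡ b
*-identityˡ-≡ b refl = ℚP.*-identityˡ b

∑-linear : ∀ M → Linear (∑ M)
∑-linear M .ext e = ∑-cong M (λ n _ _ → e n)
∑-linear zero    .add f g = refl
∑-linear (suc M) .add f g = trans (cong (_+ (f (suc M) + g (suc M))) (∑-linear M .add f g)) (interchange (∑ M f) (∑ M g) (f (suc M)) (g (suc M)))
  where
  interchange : ∀ a b c d → a + b + (c + d) ≡ a + c + (b + d)
  interchange = solve-∀ ℚ-ring
∑-linear zero    .scale r f = sym (ℚP.*-zeroʳ r)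
∑-linear (suc M) .scale r f =
  trans (cong (_+ r * f (suc M)) (∑-linear M .scale r f)) (sym (ℚP.*-distribˡ-+ r _ _))

eval-linear : ∀ {A} (a : A) → Linear (λ f → f a)
eval-linear a .ext e     = e a
eval-linear a .add f g   = refl
eval-linear a .scale r f = refl

scale-linear : ∀ {A} {Λ : (A → ℚ) → ℚ} w → Linear Λ → Linear (λ f → w * Λ f)
scale-linear w Λ-lin .ext e     = cong (w *_) (Λ-lin .ext e)
scale-linear w Λ-lin .add f g   = trans (cong (w *_) (Λ-lin .add f g)) (ℚP.*-distribˡ-+ w _ _)
scale-linear w Λ-lin .scale r f = trans (cong (w *_) (Λ-lin .scale r f)) (swap w r _)
  where
  swap : ∀ a b c → a * (b * c) ≡ b * (a * c)
  swap = solve-∀ ℚ-ring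

bind-linear : ∀ {A B} {Λ : (A → ℚ) → ℚ} {M : A → (B → ℚ) → ℚ} →
              Linear Λ → (∀ a → Linear (M a)) → Linear (λ f → Λ (λ a → M a f))
bind-linear Λ-lin M-lin .ext e     = Λ-lin .ext (λ a → M-lin a .ext e)
bind-linear Λ-lin M-lin .add f g   = trans (Λ-lin .ext (λ a → M-lin a .add f g)) (Λ-lin .add _ _)
bind-linear Λ-lin M-lin .scale r f = trans (Λ-lin .ext (λ a → M-lin a .scale r f)) (Λ-lin .scale r _)

-- The linear extension of Φ to formal combinations; `ZcycP p L` is the case where Φ is
-- `zetaCycP p ∘ map parse`.
⟪_⟫ : ∀ {A} → Lin A → (A → ℚ) → ℚ
⟪ L ⟫ Φ = sumQ (map (λ (c , a) → c * Φ a) L)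

⟪⟫-++ : ∀ {A} (L M : Lin A) Φ → ⟪ L ++ M ⟫ Φ ≡ ⟪ L ⟫ Φ + ⟪ M ⟫ Φ
⟪⟫-++ []            M Φ = sym (ℚP.+-identityˡ _)
⟪⟫-++ ((c , a) ∷ L) M Φ = trans (cong (_+_ (c * Φ a)) (⟪⟫-++ L M Φ)) (sym (ℚP.+-assoc (c * Φ a) _ _))

⟪⟫-map : ∀ {A B} (h : A → B) (L : Lin A) Φ → ⟪ map (λ (c , a) → c , h a) L ⟫ Φ ≡ ⟪ L ⟫ (Φ ∘ h)
⟪⟫-map h []            Φ = refl
⟪⟫-map h ((c , a) ∷ L) Φ = cong (_+_ (c * Φ (h a))) (⟪⟫-map h L Φ)

⟪⟫-linear : ∀ {A} (L : Lin A) → Linear ⟪ L ⟫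
⟪⟫-linear []            .ext e     = refl
⟪⟫-linear ((c , a) ∷ L) .ext e     = cong₂ _+_ (cong (c *_) (e a)) (⟪⟫-linear L .ext e)
⟪⟫-linear []            .add f g   = refl
⟪⟫-linear ((c , a) ∷ L) .add f g   =
  trans (cong (_+_ (c * (f a + g a))) (⟪⟫-linear L .add f g)) (interchange c _ _ _ _)
  where
  interchange : ∀ c a b d e → c * (a + b) + (d + e) ≡ c * a + d + (c * b + e)
  interchange = solve-∀ ℚ-ring
⟪⟫-linear []            .scale r f = sym (ℚP.*-zeroʳ r)
⟪⟫-linear ((c , a) ∷ L) .scale r f =
  trans (cong (_+_ (c * (r * f a))) (⟪⟫-linear L .scale r f)) (pull c r _ _)
  where
  pull : ∀ c r a b → c * (r * a) + r * b ≡ r * (c * a + b)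
  pull = solve-∀ ℚ-ring

comm-⟪⟫ : ∀ {A B} {Λ : (A → ℚ) → ℚ} → Linear Λ → (L : Lin B) (f : B → A → ℚ) →
          Λ (λ a → ⟪ L ⟫ (λ b → f b a)) ≡ ⟪ L ⟫ (λ b → Λ (f b))
comm-⟪⟫ Λ-lin []            f = zer Λ-lin
comm-⟪⟫ Λ-lin ((c , b) ∷ L) f =
  trans (Λ-lin .add _ _) (cong₂ _+_ (Λ-lin .scale c (f b)) (comm-⟪⟫ Λ-lin L f))

-- Indicator functions and partial sums of the harmonic series

le lt : ℕ → ℕ → ℚ
le a b = if a ≤ᵇ b then 1ℚ else 0ℚ
lt a b = if a <ᵇ b then 1ℚ else 0ℚ

lt-yes : ∀ {a b} → a < b → lt a b ≡ 1ℚ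
lt-yes {zero}  (s≤s _) = refl
lt-yes {suc a} (s≤s h) = lt-yes h

lt-no : ∀ {a b} → b ≤ a → lt a b ≡ 0ℚ
lt-no z≤n     = refl
lt-no (s≤s h) = lt-no h

lt-suc : ∀ a b → lt a (suc b) ≡ le a b
lt-suc zero    b = refl
lt-suc (suc a) b = refl

le-yes : ∀ {a b} → a ≤ b → le a b ≡ 1ℚ
le-yes {a} {b} h = trans (sym (lt-suc a b)) (lt-yes (s≤s h))

le-no : ∀ {a b} → b < a → le a b ≡ 0ℚ
le-no {a} {b} h = trans (sym (lt-suc a b)) (lt-no h)

lt-le : ∀ a b → lt a b ≡ 1ℚ - le b a
lt-le a b with ℕP.<-≤-connex a b
... | inj₁ a<b = trans (lt-yes a<b) (sym (cong (_-_ 1ℚ) (le-no a<b)))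
... | inj₂ b≤a = trans (lt-no b≤a) (sym (cong (_-_ 1ℚ) (le-yes b≤a)))

∑-le : ∀ {M N} → M ≤ N → ∀ f → ∑ N (λ n → le n M * f n) ≡ ∑ M f
∑-le {M} {N} M≤N f with ℕP.m≤n⇒m<n∨m≡n M≤N
... | inj₂ refl = ∑-cong M (λ n _ n≤M → *-identityˡ-≡ (f n) (le-yes n≤M))
∑-le {M} {suc N} M≤N f | inj₁ (s≤s M≤N′) = begin
  ∑ N (λ n → le n M * f n) + le (suc N) M * f (suc N)
    ≡⟨ cong₂ _+_ (∑-le M≤N′ f) (*-zeroˡ-≡ (f (suc N)) (le-no (s≤s M≤N′))) ⟩
  ∑ M f + 0ℚ  ≡⟨ ℚP.+-identityʳ _ ⟩
  ∑ M f       ∎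

∑-le-all : ∀ {M N} → N ≤ M → ∀ f → ∑ N (λ n → le n M * f n) ≡ ∑ N f
∑-le-all N≤M f = ∑-cong _ (λ n _ n≤N → *-identityˡ-≡ (f n) (le-yes (ℕP.≤-trans n≤N N≤M)))

∑-lt : ∀ {M N} → M ≤ N → ∀ f → ∑ N (λ n → lt M n * f n) ≡ ∑ N f - ∑ M f
∑-lt {M} {N} M≤N f = begin
  ∑ N (λ n → lt M n * f n)          ≡⟨ ∑-linear N .ext (λ n → trans (cong (_* f n) (lt-le M n)) (expand (le n M) (f n))) ⟩
  ∑ N (λ n → f n - le n M * f n)    ≡⟨ sub (∑-linear N) _ _ ⟩
  ∑ N f - ∑ N (λ n → le n M * f n)  ≡⟨ cong (_-_ (∑ N f)) (∑-le M≤N f) ⟩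
  ∑ N f - ∑ M f                     ∎
  where
  expand : ∀ a b → (1ℚ - a) * b ≡ b - a * b
  expand = solve-∀ ℚ-ring

∑-zero : ∀ M f → (∀ n → 1 ≤ n → n ≤ M → f n ≡ 0ℚ) → ∑ M f ≡ 0ℚ
∑-zero M f e = trans (∑-cong M {g = λ _ → 0ℚ} e) (zer (∑-linear M))

∑-lt-none : ∀ {M N} → N ≤ M → ∀ (f : ℕ → ℚ) → ∑ N (λ n → lt M n * f n) ≡ 0ℚ
∑-lt-none {M} {N} N≤M f = ∑-zero N (λ n → lt M n * f n) (λ n _ n≤N →
  *-zeroˡ-≡ (f n) (lt-no (ℕP.≤-trans n≤N N≤M)))

H : ℕ → ℚ
H M = ∑ M invN

-- Truncated subtraction together with `invN 0 = 0` removes the terms l ≤ n without an indicator.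
∑-inv-shift : ∀ n M → ∑ M (λ l → invN (l ∸ n)) ≡ H (M ∸ n)
∑-inv-shift n zero rewrite ℕP.0∸n≡0 n = refl
∑-inv-shift n (suc M) with ℕP.<-≤-connex M n
... | inj₁ M<n rewrite ℕP.m≤n⇒m∸n≡0 M<n =
  trans (ℚP.+-identityʳ _) (trans (∑-inv-shift n M) (cong H (ℕP.m≤n⇒m∸n≡0 (ℕP.<⇒≤ M<n))))
... | inj₂ n≤M rewrite ℕP.+-∸-assoc 1 n≤M = cong (_+ invN (suc (M ∸ n))) (∑-inv-shift n M)

-- These are the last n terms of `H M`, read from 1/M downwards.
∑-inv-top : ∀ {n M} → n ≤ M → ∑ n (λ l → invN (suc M ∸ l)) ≡ H M - H (M ∸ n)
∑-inv-top {zero}  {M} _   = sym (ℚP.+-inverseʳ (H M))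
∑-inv-top {suc n} {M} n<M = begin
  ∑ n (λ l → invN (suc M ∸ l)) + invN (M ∸ n)
    ≡⟨ cong (_+ invN (M ∸ n)) (∑-inv-top (ℕP.<⇒≤ n<M)) ⟩
  H M - H (M ∸ n) + invN (M ∸ n)
    ≡⟨ cong (λ k → H M - H k + invN k) (ℕP.+-∸-assoc 1 n<M) ⟩
  H M - (H (M ∸ suc n) + invN (suc (M ∸ suc n))) + invN (suc (M ∸ suc n))
    ≡⟨ cancel (H M) (H (M ∸ suc n)) (invN (suc (M ∸ suc n))) ⟩
  H M - H (M ∸ suc n) ∎
  where
  cancel : ∀ a b c → a - (b + c) + c ≡ a - b
  cancel = solve-∀ ℚ-ring

∑-inv-top-all : ∀ {M N} → M ≤ N → ∑ N (λ l → invN (suc M ∸ l)) ≡ H M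
∑-inv-top-all {M} {N} M≤N = begin
  ∑ N (λ l → invN (suc M ∸ l))             ≡⟨ ∑-linear N .ext trunc ⟩
  ∑ N (λ l → le l M * invN (suc M ∸ l))    ≡⟨ ∑-le M≤N _ ⟩
  ∑ M (λ l → invN (suc M ∸ l))             ≡⟨ ∑-inv-top {M} ℕP.≤-refl ⟩
  H M - H (M ∸ M)                          ≡⟨ cong (λ k → H M - H k) (ℕP.n∸n≡0 M) ⟩
  H M - 0ℚ                                 ≡⟨ ℚP.+-identityʳ _ ⟩
  H M                                      ∎
  where
  trunc : ∀ l → invN (suc M ∸ l) ≡ le l M * invN (suc M ∸ l)
  trunc l with ℕP.<-≤-connex M l
  ... | inj₁ M<l rewrite ℕP.m≤n⇒m∸n≡0 M<l = sym (ℚP.*-zeroʳ (le l M))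
  ... | inj₂ l≤M = sym (*-identityˡ-≡ (invN (suc M ∸ l)) (le-yes l≤M))

-- Under l ↦ M + 1 - l the range n < l ≤ M becomes 1, ..., M - n; the terms l > M vanish by
-- truncation.
∑-inv-reflect : ∀ n {M N} → M ≤ N → ∑ N (λ l → lt n l * invN (suc M ∸ l)) ≡ H (M ∸ n)
∑-inv-reflect n {M} {N} M≤N with ℕP.≤-total n M
... | inj₁ n≤M = begin
  ∑ N (λ l → lt n l * invN (suc M ∸ l))
    ≡⟨ ∑-lt (ℕP.≤-trans n≤M M≤N) _ ⟩
  ∑ N (λ l → invN (suc M ∸ l)) - ∑ n (λ l → invN (suc M ∸ l))
    ≡⟨ cong₂ _-_ (∑-inv-top-all M≤N) (∑-inv-top n≤M) ⟩
  H M - (H M - H (M ∸ n))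
    ≡⟨ cancel (H M) (H (M ∸ n)) ⟩
  H (M ∸ n) ∎
  where
  cancel : ∀ a b → a - (a - b) ≡ b
  cancel = solve-∀ ℚ-ring
... | inj₂ M≤n rewrite ℕP.m≤n⇒m∸n≡0 M≤n = ∑-zero N (λ l → lt n l * invN (suc M ∸ l)) vanish
  where
  vanish : ∀ l → 1 ≤ l → l ≤ N → lt n l * invN (suc M ∸ l) ≡ 0ℚ
  vanish l _ _ with ℕP.<-≤-connex n l
  ... | inj₁ n<l rewrite ℕP.m≤n⇒m∸n≡0 (ℕP.≤-trans (s≤s M≤n) n<l) = ℚP.*-zeroʳ (lt n l)
  ... | inj₂ l≤n = *-zeroˡ-≡ (invN (suc M ∸ l)) (lt-no l≤n)

-- Integers and reciprocals in ℚ

-- Defined through `fromℚᵘ`, to which `invN` at a successor also unfolds, so that equations between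
-- integers and reciprocals are checked on unnormalised fractions, without any gcd.
ι : ℤ → ℚ
ι i = fromℚᵘ (mkℚᵘ i 0)

fromℚᵘ-* : ∀ q r → fromℚᵘ q * fromℚᵘ r ≡ fromℚᵘ (q ℚᵘ.* r)
fromℚᵘ-* q r = ℚP.toℚᵘ-injective (ℚᵘP.≃-trans (ℚP.toℚᵘ-homo-* (fromℚᵘ q) (fromℚᵘ r))
  (ℚᵘP.≃-trans (ℚᵘP.*-cong (ℚP.toℚᵘ-fromℚᵘ q) (ℚP.toℚᵘ-fromℚᵘ r)) (ℚᵘP.≃-sym (ℚP.toℚᵘ-fromℚᵘ (q ℚᵘ.* r)))))

fromℚᵘ-+ : ∀ q r → fromℚᵘ q + fromℚᵘ r ≡ fromℚᵘ (q ℚᵘ.+ r)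
fromℚᵘ-+ q r = ℚP.toℚᵘ-injective (ℚᵘP.≃-trans (ℚP.toℚᵘ-homo-+ (fromℚᵘ q) (fromℚᵘ r))
  (ℚᵘP.≃-trans (ℚᵘP.+-cong (ℚP.toℚᵘ-fromℚᵘ q) (ℚP.toℚᵘ-fromℚᵘ r)) (ℚᵘP.≃-sym (ℚP.toℚᵘ-fromℚᵘ (q ℚᵘ.+ r)))))

ι-* : ∀ i j → ι (i ℤ.* j) ≡ ι i * ι j
ι-* i j = sym (fromℚᵘ-* (mkℚᵘ i 0) (mkℚᵘ j 0))

ι-+ : ∀ i j → ι (i ℤ.+ j) ≡ ι i + ι j
ι-+ i j = sym (trans (fromℚᵘ-+ (mkℚᵘ i 0) (mkℚᵘ j 0)) (ℚP.fromℚᵘ-cong {mkℚᵘ i 0 ℚᵘ.+ mkℚᵘ j 0} {mkℚᵘ (i ℤ.+ j) 0} (ℚᵘ.*≡* (cong (ℤ._* ℤ.1ℤ)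
  (cong₂ ℤ._+_ (ℤP.*-identityʳ i) (ℤP.*-identityʳ j))))))

inv-ι : ∀ n → 1 ≤ n → invN n * ι (ℤ.+ n) ≡ 1ℚ
inv-ι (suc m) _ = trans (fromℚᵘ-* (mkℚᵘ ℤ.1ℤ m) (mkℚᵘ (ℤ.+ suc m) 0))
  (ℚP.fromℚᵘ-cong {mkℚᵘ ℤ.1ℤ m ℚᵘ.* mkℚᵘ (ℤ.+ suc m) 0} {ℚᵘ.1ℚᵘ} (ℚᵘ.*≡* (begin
    ℤ.1ℤ ℤ.* (ℤ.+ suc m) ℤ.* ℤ.1ℤ  ≡⟨ ℤP.*-identityʳ (ℤ.1ℤ ℤ.* (ℤ.+ suc m)) ⟩
    ℤ.1ℤ ℤ.* (ℤ.+ suc m)           ≡⟨ cong (λ k → ℤ.1ℤ ℤ.* (ℤ.+ k)) (sym (ℕP.*-identityʳ (suc m))) ⟩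
    ℤ.1ℤ ℤ.* (ℤ.+ (suc m ℕ.* 1))   ∎)))

ι-∸ : ∀ {l m} → l ≤ m → ι (ℤ.+ m) ≡ ι (ℤ.+ l) + ι (ℤ.+ (m ∸ l))
ι-∸ {l} {m} l≤m = trans (cong (λ k → ι (ℤ.+ k)) (sym (ℕP.m+[n∸m]≡n l≤m))) (ι-+ (ℤ.+ l) (ℤ.+ (m ∸ l)))

-- This is 1/l - 1/m = (m - l)/(l m) divided by m - l; it supplies the hypothesis of
-- `ytildePairs-kernel`.
inv-∸ : ∀ {l m} → 1 ≤ l → l < m → invN (m ∸ l) * (invN l - invN m) ≡ invN l * invN m
inv-∸ {l} {m} 1≤l l<m = begin
  d * (u - v)
    -- The factors v M = 1 and u L = 1 bring in the integers; then M = L + D leaves d D = 1.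
    ≡⟨ cong₂ (λ s t → d * (s - t)) (sym (*-identityˡ-≡ u vM)) (sym (*-identityˡ-≡ v uL)) ⟩
  d * (v * M * u - u * L * v)
    ≡⟨ cong (λ s → d * (v * s * u - u * L * v)) (ι-∸ (ℕP.<⇒≤ l<m)) ⟩
  d * (v * (L + D) * u - u * L * v)
    ≡⟨ collect d u v L D ⟩
  d * D * (u * v)
    ≡⟨ *-identityˡ-≡ (u * v) (inv-ι (m ∸ l) (ℕP.m<n⇒0<n∸m l<m)) ⟩
  u * v ∎
  where
  u = invN l
  v = invN m
  d = invN (m ∸ l)
  L = ι (ℤ.+ l)
  M = ι (ℤ.+ m)
  D = ι (ℤ.+ (m ∸ l))
  uL = inv-ι l 1≤l
  vM = inv-ι m (ℕP.≤-trans (s≤s z≤n) l<m)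
  collect : ∀ d u v L D → d * (v * (L + D) * u - u * L * v) ≡ d * D * (u * v)
  collect = solve-∀ ℚ-ring

-- The quasi-derivation on a single letter

splits : ℕ → List (ℕ × ℕ)
splits zero    = (0 , 0) ∷ []
splits (suc m) = (0 , suc m) ∷ map (λ (a , b) → suc a , b) (splits m)

-- The entry `(c , (i , j))` stands for c z_i z_j. For k ≥ 3 the words are y x (x^b y x^a) x =
-- z_(b+2) z_(a+2) with a + b = k - 3.
ytildePairs : ℕ → Lin (ℕ × ℕ)
ytildePairs zero                = []
ytildePairs (suc zero)          = (- 1ℚ , (1 , 1)) ∷ []
ytildePairs (suc (suc zero))    = []
ytildePairs (suc (suc (suc m))) = map (λ (a , b) → 1ℚ , (2 ℕ.+ b , 2 ℕ.+ a)) (splits m)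

module _ (u v : ℚ) where

  monomial : ℕ × ℕ → ℚ
  monomial (i , j) = powQ u i * powQ v j

  -- Passing to the next exponent adds one pair with second entry 2 and raises the second entry of
  -- every other pair by one.
  ytildePairs-split : ∀ m → ⟪ ytildePairs (4 ℕ.+ m) ⟫ monomial ≡
    powQ u (3 ℕ.+ m) * powQ v 2 + v * ⟪ ytildePairs (3 ℕ.+ m) ⟫ monomial
  ytildePairs-split m = cong₂ _+_ (ℚP.*-identityˡ (monomial (3 ℕ.+ m , 2))) (shift (splits m))
    where
    pull : ∀ v a b c → 1ℚ * (a * (v * b)) + v * c ≡ v * (1ℚ * (a * b) + c)
    pull = solve-∀ ℚ-ring
    shift : ∀ L →
      sumQ (map (λ (c , p) → c * monomial p) (map (λ (a , b) → 1ℚ , (2 ℕ.+ b , 2 ℕ.+ a)) (map (λ (a , b) → suc a , b) L)))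
        ≡ v * sumQ (map (λ (c , p) → c * monomial p) (map (λ (a , b) → 1ℚ , (2 ℕ.+ b , 2 ℕ.+ a)) L))
    shift []            = sym (ℚP.*-zeroʳ v)
    shift ((a , b) ∷ L) = trans
      (cong (_+_ (1ℚ * (powQ u (2 ℕ.+ b) * (v * powQ v (2 ℕ.+ a))))) (shift L))
      (pull v (powQ u (2 ℕ.+ b)) (powQ v (2 ℕ.+ a))
        (sumQ (map (λ (c , p) → c * monomial p) (map (λ (a , b) → 1ℚ , (2 ℕ.+ b , 2 ℕ.+ a)) L))))

  -- ytildePairs k is ∑ uⁱ vʲ over i + j = k + 1 with i, j ≥ 1, less the terms u vᵏ and uᵏ v; the full
  -- sum is (uᵏ − vᵏ) d.  For k = 1 both removed terms are the single term of the sum.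
  ytildePairs-kernel : ∀ d → d * (u - v) ≡ u * v → ∀ k → 1 ≤ k →
    ⟪ ytildePairs k ⟫ monomial ≡ powQ u k * (d - v) - powQ v k * (d + u)
  ytildePairs-kernel d e (suc zero) _ = begin
    - 1ℚ * (u * 1ℚ * (v * 1ℚ)) + 0ℚ                  ≡⟨ one u v ⟩
    u * v - (1ℚ + 1ℚ) * (u * v)                      ≡⟨ cong (_- (1ℚ + 1ℚ) * (u * v)) (sym e) ⟩
    d * (u - v) - (1ℚ + 1ℚ) * (u * v)                ≡⟨ two d u v ⟩
    u * 1ℚ * (d - v) - v * 1ℚ * (d + u)              ∎
    where
    one : ∀ u v → - 1ℚ * (u * 1ℚ * (v * 1ℚ)) + 0ℚ ≡ u * v - (1ℚ + 1ℚ) * (u * v)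
    one = solve-∀ ℚ-ring
    two : ∀ d u v → d * (u - v) - (1ℚ + 1ℚ) * (u * v) ≡ u * 1ℚ * (d - v) - v * 1ℚ * (d + u)
    two = solve-∀ ℚ-ring
  ytildePairs-kernel d e (suc (suc zero)) _ = begin
    0ℚ                                                       ≡⟨ one u v ⟩
    u * v * (u + v) - u * v * (u + v)                        ≡⟨ cong (λ t → t * (u + v) - u * v * (u + v)) (sym e) ⟩
    d * (u - v) * (u + v) - u * v * (u + v)                  ≡⟨ two d u v ⟩
    u * (u * 1ℚ) * (d - v) - v * (v * 1ℚ) * (d + u)          ∎
    where
    one : ∀ u v → 0ℚ ≡ u * v * (u + v) - u * v * (u + v)
    one = solve-∀ ℚ-ring
    two : ∀ d u v → d * (u - v) * (u + v) - u * v * (u + v) ≡ u * (u * 1ℚ) * (d - v) - v * (v * 1ℚ) * (d + u)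
    two = solve-∀ ℚ-ring
  ytildePairs-kernel d e (suc (suc (suc zero))) _ = begin
    1ℚ * (u * (u * 1ℚ) * (v * (v * 1ℚ))) + 0ℚ
      ≡⟨ one u v ⟩
    u * v * (u * u + u * v + v * v) - u * v * (u * u + v * v)
      ≡⟨ cong (λ t → t * (u * u + u * v + v * v) - u * v * (u * u + v * v)) (sym e) ⟩
    d * (u - v) * (u * u + u * v + v * v) - u * v * (u * u + v * v)
      ≡⟨ two d u v ⟩
    u * (u * (u * 1ℚ)) * (d - v) - v * (v * (v * 1ℚ)) * (d + u) ∎
    where
    one : ∀ u v → 1ℚ * (u * (u * 1ℚ) * (v * (v * 1ℚ))) + 0ℚ
                ≡ u * v * (u * u + u * v + v * v) - u * v * (u * u + v * v)
    one = solve-∀ ℚ-ring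
    two : ∀ d u v → d * (u - v) * (u * u + u * v + v * v) - u * v * (u * u + v * v)
                  ≡ u * (u * (u * 1ℚ)) * (d - v) - v * (v * (v * 1ℚ)) * (d + u)
    two = solve-∀ ℚ-ring
  ytildePairs-kernel d e (suc (suc (suc (suc m)))) _ = begin
    ⟪ ytildePairs (4 ℕ.+ m) ⟫ monomial
      ≡⟨ ytildePairs-split m ⟩
    U * powQ v 2 + v * ⟪ ytildePairs (3 ℕ.+ m) ⟫ monomial
      ≡⟨ cong (λ t → U * powQ v 2 + v * t) (ytildePairs-kernel d e (suc (suc (suc m))) (s≤s z≤n)) ⟩
    U * (v * (v * 1ℚ)) + v * (U * (d - v) - V * (d + u))
      ≡⟨ one d u v U V ⟩
    u * v * U + (U * (v * d - u * v) - v * V * (d + u))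
      ≡⟨ cong (λ t → t * U + (U * (v * d - u * v) - v * V * (d + u))) (sym e) ⟩
    d * (u - v) * U + (U * (v * d - u * v) - v * V * (d + u))
      ≡⟨ two d u v U V ⟩
    u * U * (d - v) - v * V * (d + u) ∎
    where
    U = powQ u (3 ℕ.+ m)
    V = powQ v (3 ℕ.+ m)
    one : ∀ d u v U V → U * (v * (v * 1ℚ)) + v * (U * (d - v) - V * (d + u))
                      ≡ u * v * U + (U * (v * d - u * v) - v * V * (d + u))
    one = solve-∀ ℚ-ring
    two : ∀ d u v U V → d * (u - v) * U + (U * (v * d - u * v) - v * V * (d + u))
                      ≡ u * U * (d - v) - v * V * (d + u)
    two = solve-∀ ℚ-ring

-- Since invN 0 = 0, invN (m ∸ l) is 1/(m − l) for l < m and 0 otherwise.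
α β : ℕ → ℕ → ℚ
α l m = invN (m ∸ l) - lt l m * invN m
β l m = invN (m ∸ l) + lt l m * invN l

-- For m ≤ l both kernels vanish together with `lt l m`, so the identity holds on the whole square
-- and the two powers can be summed separately over full ranges.
pair-kernel : ∀ k l m → 1 ≤ k → 1 ≤ l →
  ⟪ ytildePairs k ⟫ (monomial (invN l) (invN m)) * lt l m
    ≡ powQ (invN l) k * α l m - powQ (invN m) k * β l m
pair-kernel k l m 1≤k 1≤l with ℕP.<-≤-connex l m
... | inj₁ l<m = expand (invN (m ∸ l)) (invN l) (invN m) (powQ (invN l) k) (powQ (invN m) k) (lt-yes l<m)
  (ytildePairs-kernel (invN l) (invN m) (invN (m ∸ l)) (inv-∸ 1≤l l<m) k 1≤k)
  where
  ring : ∀ d u v U V → (U * (d - v) - V * (d + u)) * 1ℚ ≡ U * (d - 1ℚ * v) - V * (d + 1ℚ * u)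
  ring = solve-∀ ℚ-ring
  expand : ∀ {t K} d u v U V → t ≡ 1ℚ → K ≡ U * (d - v) - V * (d + u) →
           K * t ≡ U * (d - t * v) - V * (d + t * u)
  expand d u v U V refl refl = ring d u v U V
... | inj₂ m≤l = vanish (⟪ ytildePairs k ⟫ (monomial (invN l) (invN m))) (invN l) (invN m) (powQ (invN l) k) (powQ (invN m) k)
  (lt-no m≤l) (cong invN (ℕP.m≤n⇒m∸n≡0 m≤l))
  where
  ring : ∀ K u v U V → K * 0ℚ ≡ U * (0ℚ - 0ℚ * v) - V * (0ℚ + 0ℚ * u)
  ring = solve-∀ ℚ-ring
  vanish : ∀ {t d} K u v U V → t ≡ 0ℚ → d ≡ 0ℚ → K * t ≡ U * (d - t * v) - V * (d + t * u)
  vanish K u v U V refl refl = ring K u v U V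

∑-inv-between : ∀ n {m N} → m ≤ N →
  ∑ N (λ l → le l m * (lt n l * invN l)) ≡ lt n (suc m) * (H m - H n)
∑-inv-between n {m} {N} m≤N with ℕP.≤-<-connex n m
... | inj₁ n≤m = begin
  ∑ N (λ l → le l m * (lt n l * invN l))  ≡⟨ ∑-le m≤N (λ l → lt n l * invN l) ⟩
  ∑ m (λ l → lt n l * invN l)             ≡⟨ ∑-lt n≤m invN ⟩
  H m - H n                               ≡⟨ sym (*-identityˡ-≡ (H m - H n) (lt-yes (s≤s n≤m))) ⟩
  lt n (suc m) * (H m - H n)              ∎
... | inj₂ m<n = begin
  ∑ N (λ l → le l m * (lt n l * invN l))  ≡⟨ ∑-le m≤N (λ l → lt n l * invN l) ⟩
  ∑ m (λ l → lt n l * invN l)             ≡⟨ ∑-lt-none (ℕP.<⇒≤ m<n) invN ⟩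
  0ℚ                                      ≡⟨ sym (*-zeroˡ-≡ (H m - H n) (lt-no m<n)) ⟩
  lt n (suc m) * (H m - H n)              ∎

-- Reflecting l ↦ n + m − l makes the terms 1/(l − n) and 1/(m − l) cancel.
∑-α-β : ∀ n m {N} → 1 ≤ m → m ≤ N →
  ∑ N (λ l → α n l * lt l m) - ∑ N (λ l → lt n l * β l m) ≡ - 2ℚ * (lt n m * (H m - invN m - H n))
∑-α-β n (suc m) {N} _ m<N = begin
  ∑ N (λ l → α n l * lt l (suc m)) - ∑ N (λ l → lt n l * β l (suc m))
    ≡⟨ cong₂ _-_ left right ⟩
  H (m ∸ n) - G - (H (m ∸ n) + G)
    ≡⟨ ring₁ (H (m ∸ n)) G ⟩
  - 2ℚ * G
    ≡⟨ cong (- 2ℚ *_) (∑-inv-between n m≤N) ⟩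
  - 2ℚ * (lt n (suc m) * (H m - H n))
    ≡⟨ cong (λ q → - 2ℚ * (lt n (suc m) * q)) (ring₂ (H m) (invN (suc m)) (H n)) ⟩
  - 2ℚ * (lt n (suc m) * (H m + invN (suc m) - invN (suc m) - H n)) ∎
  where
  m≤N : m ≤ N
  m≤N = ℕP.<⇒≤ m<N
  G : ℚ
  G = ∑ N (λ l → le l m * (lt n l * invN l))
  ring₁ : ∀ a b → a - b - (a + b) ≡ - (1ℚ + 1ℚ) * b
  ring₁ = solve-∀ ℚ-ring
  ring₂ : ∀ a b c → a - c ≡ a + b - b - c
  ring₂ = solve-∀ ℚ-ring
  ring₃ : ∀ a b c d → (a - b * c) * d ≡ d * a - d * (b * c)
  ring₃ = solve-∀ ℚ-ring
  ring₄ : ∀ a b c d → b * (a + d * c) ≡ b * a + d * (b * c)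
  ring₄ = solve-∀ ℚ-ring
  left : ∑ N (λ l → α n l * lt l (suc m)) ≡ H (m ∸ n) - G
  left = begin
    ∑ N (λ l → α n l * lt l (suc m))
      ≡⟨ ∑-linear N .ext (λ l → trans (cong (α n l *_) (lt-suc l m)) (ring₃ (invN (l ∸ n)) (lt n l) (invN l) (le l m))) ⟩
    ∑ N (λ l → le l m * invN (l ∸ n) - le l m * (lt n l * invN l))
      ≡⟨ sub (∑-linear N) (λ l → le l m * invN (l ∸ n)) (λ l → le l m * (lt n l * invN l)) ⟩
    ∑ N (λ l → le l m * invN (l ∸ n)) - G
      ≡⟨ cong (_- G) (trans (∑-le m≤N (λ l → invN (l ∸ n))) (∑-inv-shift n m)) ⟩
    H (m ∸ n) - G ∎
  right : ∑ N (λ l → lt n l * β l (suc m)) ≡ H (m ∸ n) + G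
  right = begin
    ∑ N (λ l → lt n l * β l (suc m))
      ≡⟨ ∑-linear N .ext (λ l → trans (cong (λ t → lt n l * (invN (suc m ∸ l) + t * invN l)) (lt-suc l m))
                                      (ring₄ (invN (suc m ∸ l)) (lt n l) (invN l) (le l m))) ⟩
    ∑ N (λ l → lt n l * invN (suc m ∸ l) + le l m * (lt n l * invN l))
      ≡⟨ ∑-linear N .add (λ l → lt n l * invN (suc m ∸ l)) (λ l → le l m * (lt n l * invN l)) ⟩
    ∑ N (λ l → lt n l * invN (suc m ∸ l)) + G
      ≡⟨ cong (_+ G) (∑-inv-reflect n m≤N) ⟩
    H (m ∸ n) + G ∎

-- Both operators of the theorem on index lists

ytildeIndices : List ℕ → Lin (List ℕ)
ytildeIndices []       = []
ytildeIndices (k ∷ ks) =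
  map (λ (c , p) → c , (proj₁ p ∷ proj₂ p ∷ ks)) (ytildePairs k)
  ++ map (λ (c , u) → c , k ∷ u) (ytildeIndices ks)

incIndices : List ℕ → Lin (List ℕ)
incIndices []       = []
incIndices (k ∷ ks) = (1ℚ , suc k ∷ ks) ∷ map (λ (c , u) → c , k ∷ u) (incIndices ks)

ytildeIndices-∷ : ∀ k ks Φ → ⟪ ytildeIndices (k ∷ ks) ⟫ Φ ≡
  ⟪ ytildePairs k ⟫ (λ p → Φ (proj₁ p ∷ proj₂ p ∷ ks)) + ⟪ ytildeIndices ks ⟫ (λ u → Φ (k ∷ u))
ytildeIndices-∷ k ks Φ = trans
  (⟪⟫-++ (map (λ (c , p) → c , (proj₁ p ∷ proj₂ p ∷ ks)) (ytildePairs k)) _ Φ)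
  (cong₂ _+_ (⟪⟫-map (λ p → proj₁ p ∷ proj₂ p ∷ ks) (ytildePairs k) Φ) (⟪⟫-map (k ∷_) (ytildeIndices ks) Φ))

incIndices-∷ : ∀ k ks Φ → ⟪ incIndices (k ∷ ks) ⟫ Φ ≡
  1ℚ * Φ (suc k ∷ ks) + ⟪ incIndices ks ⟫ (λ u → Φ (k ∷ u))
incIndices-∷ k ks Φ = cong (_+_ (1ℚ * Φ (suc k ∷ ks))) (⟪⟫-map (k ∷_) (incIndices ks) Φ)

slotwise : (List ℕ → Lin (List ℕ)) → List (List ℕ) → Lin (List (List ℕ))
slotwise g []         = []
slotwise g (ks ∷ kss) =
  map (λ (c , u) → c , u ∷ kss) (g ks) ++ map (λ (c , t) → c , ks ∷ t) (slotwise g kss)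

slotwise-∷ : ∀ g ks kss Φ → ⟪ slotwise g (ks ∷ kss) ⟫ Φ ≡
  ⟪ g ks ⟫ (λ u → Φ (u ∷ kss)) + ⟪ slotwise g kss ⟫ (λ t → Φ (ks ∷ t))
slotwise-∷ g ks kss Φ = trans
  (⟪⟫-++ (map (λ (c , u) → c , u ∷ kss) (g ks)) (map (λ (c , t) → c , ks ∷ t) (slotwise g kss)) Φ)
  (cong₂ _+_ (⟪⟫-map (_∷ kss) (g ks) Φ) (⟪⟫-map (ks ∷_) (slotwise g kss) Φ))

-- Insertions along one slot

module _ (N : ℕ) where

  -- The last summation index, or n for the empty list, is handed to ψ, through which the cyclic
  -- condition enters later.
  chain : ℕ → List ℕ → (ℕ → ℚ) → ℚ
  chain n []       ψ = ψ n
  chain n (k ∷ ks) ψ = ∑ N (λ m → powQ (invN m) k * (lt n m * chain m ks ψ))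

  -- φ receives the first and the last index; the value (0 , 0) for the empty slot matches `hd []`
  -- and `lst []`.
  slot : List ℕ → (ℕ × ℕ → ℚ) → ℚ
  slot []       φ = φ (0 , 0)
  slot (k ∷ ks) φ = ∑ N (λ m → powQ (invN m) k * chain m ks (λ b → φ (m , b)))

  chain-linear : ∀ n ks → Linear (chain n ks)
  chain-linear n []       = eval-linear n
  chain-linear n (k ∷ ks) = bind-linear (∑-linear N) (λ m →
    scale-linear (powQ (invN m) k) (scale-linear (lt n m) (chain-linear m ks)))

  slot-linear : ∀ ks → Linear (slot ks)
  slot-linear []       = eval-linear (0 , 0)
  slot-linear (k ∷ ks) = bind-linear (∑-linear N) (λ m →
    scale-linear (powQ (invN m) k) (bind-linear (chain-linear m ks) (λ b → eval-linear (m , b))))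

  -- By `pair-kernel` the exponent k sits on the smaller index in one term and on the larger index
  -- in the other. The index that carries it is the original one, and the other is the inserted one.
  ytildePairs-∑ : ∀ k (g : ℕ → ℕ → ℚ) → 1 ≤ k →
    ⟪ ytildePairs k ⟫ (λ p → ∑ N (λ l → powQ (invN l) (proj₁ p) *
                             ∑ N (λ m → powQ (invN m) (proj₂ p) * (lt l m * g l m))))
      ≡ ∑ N (λ l → powQ (invN l) k * ∑ N (λ m → α l m * g l m))
      - ∑ N (λ m → powQ (invN m) k * ∑ N (λ l → β l m * g l m))
  ytildePairs-∑ k g 1≤k = begin
    ⟪ L ⟫ (λ p → ∑ N (λ l → powQ (invN l) (proj₁ p) * ∑ N (λ m → powQ (invN m) (proj₂ p) * w l m)))
      ≡⟨ ⟪⟫-linear L .ext (λ p → ∑-linear N .ext (λ l → merge p l)) ⟩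
    ⟪ L ⟫ (λ p → ∑ N (λ l → ∑ N (λ m → monomial (invN l) (invN m) p * w l m)))
      ≡⟨ comm-∑ (⟪⟫-linear L) N (λ l p → ∑ N (λ m → monomial (invN l) (invN m) p * w l m)) ⟩
    ∑ N (λ l → ⟪ L ⟫ (λ p → ∑ N (λ m → monomial (invN l) (invN m) p * w l m)))
      ≡⟨ ∑-linear N .ext (λ l → comm-∑ (⟪⟫-linear L) N (λ m p → monomial (invN l) (invN m) p * w l m)) ⟩
    ∑ N (λ l → ∑ N (λ m → ⟪ L ⟫ (λ p → monomial (invN l) (invN m) p * w l m)))
      ≡⟨ ∑-cong N (λ l 1≤l _ → ∑-linear N .ext (λ m → kernel l m 1≤l)) ⟩
    ∑ N (λ l → ∑ N (λ m → A l m - B l m))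
      ≡⟨ ∑-linear N .ext (λ l → sub (∑-linear N) (A l) (B l)) ⟩
    ∑ N (λ l → ∑ N (A l) - ∑ N (B l))
      ≡⟨ sub (∑-linear N) (λ l → ∑ N (A l)) (λ l → ∑ N (B l)) ⟩
    ∑ N (λ l → ∑ N (A l)) - ∑ N (λ l → ∑ N (B l))
      ≡⟨ cong₂ _-_
           (∑-linear N .ext (λ l → ∑-linear N .scale (powQ (invN l) k) (λ m → α l m * g l m)))
           -- Here the larger index m is the original one and has to become the outer variable.
           (trans (comm-∑ (∑-linear N) N (λ m l → B l m))
                  (∑-linear N .ext (λ m → ∑-linear N .scale (powQ (invN m) k) (λ l → β l m * g l m)))) ⟩
    ∑ N (λ l → powQ (invN l) k * ∑ N (λ m → α l m * g l m))
      - ∑ N (λ m → powQ (invN m) k * ∑ N (λ l → β l m * g l m)) ∎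
    where
    L : Lin (ℕ × ℕ)
    L = ytildePairs k
    w A B : ℕ → ℕ → ℚ
    w l m = lt l m * g l m
    A l m = powQ (invN l) k * (α l m * g l m)
    B l m = powQ (invN m) k * (β l m * g l m)
    merge : ∀ p l → powQ (invN l) (proj₁ p) * ∑ N (λ m → powQ (invN m) (proj₂ p) * w l m)
                  ≡ ∑ N (λ m → monomial (invN l) (invN m) p * w l m)
    merge p l = trans (sym (∑-linear N .scale (powQ (invN l) (proj₁ p)) (λ m → powQ (invN m) (proj₂ p) * w l m)))
      (∑-linear N .ext (λ m → sym (ℚP.*-assoc (powQ (invN l) (proj₁ p)) (powQ (invN m) (proj₂ p)) (w l m))))
    ring : ∀ U V a b c → (U * a - V * b) * c ≡ U * (a * c) - V * (b * c)
    ring = solve-∀ ℚ-ring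
    kernel : ∀ l m → 1 ≤ l → ⟪ L ⟫ (λ p → monomial (invN l) (invN m) p * w l m) ≡ A l m - B l m
    kernel l m 1≤l = begin
      ⟪ L ⟫ (λ p → monomial (invN l) (invN m) p * w l m)
        ≡⟨ scaleʳ (⟪⟫-linear L) (monomial (invN l) (invN m)) (w l m) ⟩
      ⟪ L ⟫ (monomial (invN l) (invN m)) * (lt l m * g l m)
        ≡⟨ sym (ℚP.*-assoc (⟪ L ⟫ (monomial (invN l) (invN m))) (lt l m) (g l m)) ⟩
      ⟪ L ⟫ (monomial (invN l) (invN m)) * lt l m * g l m
        ≡⟨ cong (_* g l m) (pair-kernel k l m 1≤k 1≤l) ⟩
      (powQ (invN l) k * α l m - powQ (invN m) k * β l m) * g l m
        ≡⟨ ring (powQ (invN l) k) (powQ (invN m) k) (α l m) (β l m) (g l m) ⟩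
      A l m - B l m ∎

  moved : (ℕ → ℚ) → ℚ → ℕ → (ℕ → ℚ) → ℚ
  moved w r n χ = ∑ N (λ m → w m * χ m) - r * χ n

  -- The effect of inserting an extra summation index beyond the last (first) index of a slot, after
  -- which the condition on the last (first) index applies to the inserted one; the harmonic term is
  -- what remains of the interior insertions, which telescope along the slot.
  moveLast moveFirst : (ℕ → ℚ) → ℕ → ℚ
  moveLast  ψ b = moved (α b) (2ℚ * H b) b ψ
  moveFirst χ a = moved (λ l → β l a) (2ℚ * (H a - invN a)) a χ

  ytildeChain incChain extendChain : ℕ → List ℕ → (ℕ → ℚ) → ℚ
  ytildeChain n ks ψ = ⟪ ytildeIndices ks ⟫ (λ u → chain n u ψ)
  incChain    n ks ψ = ⟪ incIndices ks ⟫ (λ u → chain n u ψ)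
  extendChain n ks ψ = ∑ N (λ m → α n m * chain m ks ψ)

  comm-chain-∷ : ∀ (L : Lin (List ℕ)) k n ψ →
    ⟪ L ⟫ (λ u → chain n (k ∷ u) ψ)
      ≡ ∑ N (λ m → powQ (invN m) k * (lt n m * ⟪ L ⟫ (λ u → chain m u ψ)))
  comm-chain-∷ L k n ψ = trans
    (comm-∑ (⟪⟫-linear L) N (λ m u → powQ (invN m) k * (lt n m * chain m u ψ)))
    (∑-linear N .ext (λ m → trans (⟪⟫-linear L .scale (powQ (invN m) k) (λ u → lt n m * chain m u ψ))
      (cong (powQ (invN m) k *_) (⟪⟫-linear L .scale (lt n m) (λ u → chain m u ψ)))))

  -- The gap between n and the head index receives insertions from both sides, but those coming from
  -- n belong to a letter in front of `ks`. Adding them as `extendChain` completes every gap, so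
  -- that the induction can apply `∑-α-β`; `H n` is the potential in which the gaps telescope.
  ytildeChain-extendChain : ∀ n ks ψ → All (1 ≤_) ks →
    ytildeChain n ks ψ + extendChain n ks ψ
      ≡ 2ℚ * (incChain n ks ψ + H n * chain n ks ψ) + chain n ks (moveLast ψ)
  ytildeChain-extendChain n [] ψ [] = ring (∑ N (λ m → α n m * ψ m)) (H n) (ψ n)
    where
    ring : ∀ r h p → 0ℚ + r ≡ (1ℚ + 1ℚ) * (0ℚ + h * p) + (r - (1ℚ + 1ℚ) * h * p)
    ring = solve-∀ ℚ-ring
  ytildeChain-extendChain n (k ∷ ks) ψ (1≤k ∷ ks≥1) = begin
    ytildeChain n (k ∷ ks) ψ + extendChain n (k ∷ ks) ψ
      ≡⟨ cong₂ _+_ (trans (ytildeIndices-∷ k ks (λ u → chain n u ψ))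
                     (cong₂ _+_ pairs (comm-chain-∷ (ytildeIndices ks) k n ψ))) extend ⟩
    ∑ N f₁ - ∑ N f₂ + ∑ N f₃ + ∑ N f₄
      ≡⟨ sym (∑-combine f₁ f₂ f₃ f₄) ⟩
    ∑ N (λ m → f₁ m - f₂ m + f₃ m + f₄ m)
      ≡⟨ ∑-cong N pointwise ⟩
    ∑ N (λ m → 2ℚ * (1ℚ * g₁ m + g₂ m + H n * g₃ m) + g₄ m)
      ≡⟨ ∑-combine′ ⟩
    2ℚ * (1ℚ * ∑ N g₁ + ∑ N g₂ + H n * ∑ N g₃) + ∑ N g₄
      ≡⟨ cong (λ q → 2ℚ * (q + H n * ∑ N g₃) + ∑ N g₄)
           (sym (trans (incIndices-∷ k ks (λ u → chain n u ψ))
                  (cong (_+_ (1ℚ * ∑ N g₁)) (comm-chain-∷ (incIndices ks) k n ψ)))) ⟩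
    2ℚ * (incChain n (k ∷ ks) ψ + H n * chain n (k ∷ ks) ψ) + chain n (k ∷ ks) (moveLast ψ) ∎
    where
    x^k C : ℕ → ℚ
    x^k m = powQ (invN m) k
    C m = chain m ks ψ
    -- `f₁` and `f₂` insert above and below the head index, `f₃` acts on a later letter, and `f₄`
    -- inserts above n. Thus `f₂` and `f₄` fill the same gap. In `g₁` the exponent of the head is
    -- raised.
    f₁ f₂ f₃ f₄ g₁ g₂ g₃ g₄ : ℕ → ℚ
    f₁ l = x^k l * (lt n l * extendChain l ks ψ)
    f₂ m = x^k m * (∑ N (λ l → lt n l * β l m) * C m)
    f₃ m = x^k m * (lt n m * ytildeChain m ks ψ)
    f₄ m = x^k m * (∑ N (λ l → α n l * lt l m) * C m)
    g₁ m = invN m * x^k m * (lt n m * C m)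
    g₂ m = x^k m * (lt n m * incChain m ks ψ)
    g₃ m = x^k m * (lt n m * C m)
    g₄ m = x^k m * (lt n m * chain m ks (moveLast ψ))

    swap : ∀ a b c → a * (b * c) ≡ b * (a * c)
    swap = solve-∀ ℚ-ring
    swap′ : ∀ a b c d → a * (b * (c * d)) ≡ b * (a * c * d)
    swap′ = solve-∀ ℚ-ring
    swap″ : ∀ a b c → a * (b * c) ≡ b * a * c
    swap″ = solve-∀ ℚ-ring

    pairs : ⟪ ytildePairs k ⟫ (λ p → chain n (proj₁ p ∷ proj₂ p ∷ ks) ψ) ≡ ∑ N f₁ - ∑ N f₂
    pairs = begin
      ⟪ ytildePairs k ⟫ (λ p → chain n (proj₁ p ∷ proj₂ p ∷ ks) ψ)
        ≡⟨ ⟪⟫-linear (ytildePairs k) .ext (λ p → ∑-linear N .ext (λ l → cong (powQ (invN l) (proj₁ p) *_)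
             (trans (sym (∑-linear N .scale (lt n l) (λ m → powQ (invN m) (proj₂ p) * (lt l m * C m))))
               (∑-linear N .ext (λ m → trans
                 (swap (lt n l) (powQ (invN m) (proj₂ p)) (lt l m * C m))
                 (cong (powQ (invN m) (proj₂ p) *_) (swap (lt n l) (lt l m) (C m)))))))) ⟩
      ⟪ ytildePairs k ⟫ (λ p → ∑ N (λ l → powQ (invN l) (proj₁ p) *
                               ∑ N (λ m → powQ (invN m) (proj₂ p) * (lt l m * (lt n l * C m)))))
        ≡⟨ ytildePairs-∑ k (λ l m → lt n l * C m) 1≤k ⟩
      ∑ N (λ l → x^k l * ∑ N (λ m → α l m * (lt n l * C m)))
        - ∑ N (λ m → x^k m * ∑ N (λ l → β l m * (lt n l * C m)))
        ≡⟨ cong₂ _-_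
             (∑-linear N .ext (λ l → cong (x^k l *_) (trans
               (∑-linear N .ext (λ m → swap (α l m) (lt n l) (C m)))
               (∑-linear N .scale (lt n l) (λ m → α l m * C m)))))
             (∑-linear N .ext (λ m → cong (x^k m *_) (trans
               (∑-linear N .ext (λ l → swap″ (β l m) (lt n l) (C m)))
               (scaleʳ (∑-linear N) (λ l → lt n l * β l m) (C m))))) ⟩
      ∑ N f₁ - ∑ N f₂ ∎

    extend : extendChain n (k ∷ ks) ψ ≡ ∑ N f₄
    extend = begin
      ∑ N (λ l → α n l * ∑ N (λ m → x^k m * (lt l m * C m)))
        ≡⟨ ∑-linear N .ext (λ l → trans
             (sym (∑-linear N .scale (α n l) (λ m → x^k m * (lt l m * C m))))
             (∑-linear N .ext (λ m → swap′ (α n l) (x^k m) (lt l m) (C m)))) ⟩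
      ∑ N (λ l → ∑ N (λ m → x^k m * (α n l * lt l m * C m)))
        ≡⟨ comm-∑ (∑-linear N) N (λ m l → x^k m * (α n l * lt l m * C m)) ⟩
      ∑ N (λ m → ∑ N (λ l → x^k m * (α n l * lt l m * C m)))
        ≡⟨ ∑-linear N .ext (λ m → trans
             (∑-linear N .scale (x^k m) (λ l → α n l * lt l m * C m))
             (cong (x^k m *_) (scaleʳ (∑-linear N) (λ l → α n l * lt l m) (C m)))) ⟩
      ∑ N f₄ ∎

    ∑-combine : ∀ f g h i → ∑ N (λ m → f m - g m + h m + i m) ≡ ∑ N f - ∑ N g + ∑ N h + ∑ N i
    ∑-combine f g h i = trans (∑-linear N .add (λ m → f m - g m + h m) i)
      (cong (_+ ∑ N i) (trans (∑-linear N .add (λ m → f m - g m) h)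
        (cong (_+ ∑ N h) (sub (∑-linear N) f g))))

    ∑-combine′ : ∑ N (λ m → 2ℚ * (1ℚ * g₁ m + g₂ m + H n * g₃ m) + g₄ m)
               ≡ 2ℚ * (1ℚ * ∑ N g₁ + ∑ N g₂ + H n * ∑ N g₃) + ∑ N g₄
    ∑-combine′ = begin
      ∑ N (λ m → 2ℚ * (1ℚ * g₁ m + g₂ m + H n * g₃ m) + g₄ m)
        ≡⟨ ∑-linear N .add (λ m → 2ℚ * (1ℚ * g₁ m + g₂ m + H n * g₃ m)) g₄ ⟩
      ∑ N (λ m → 2ℚ * (1ℚ * g₁ m + g₂ m + H n * g₃ m)) + ∑ N g₄
        ≡⟨ cong (_+ ∑ N g₄) (∑-linear N .scale 2ℚ (λ m → 1ℚ * g₁ m + g₂ m + H n * g₃ m)) ⟩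
      2ℚ * ∑ N (λ m → 1ℚ * g₁ m + g₂ m + H n * g₃ m) + ∑ N g₄
        ≡⟨ cong (λ q → 2ℚ * q + ∑ N g₄) (∑-linear N .add (λ m → 1ℚ * g₁ m + g₂ m) (λ m → H n * g₃ m)) ⟩
      2ℚ * (∑ N (λ m → 1ℚ * g₁ m + g₂ m) + ∑ N (λ m → H n * g₃ m)) + ∑ N g₄
        ≡⟨ cong₂ (λ q r → 2ℚ * (q + r) + ∑ N g₄)
             (trans (∑-linear N .add (λ m → 1ℚ * g₁ m) g₂) (cong (_+ ∑ N g₂) (∑-linear N .scale 1ℚ g₁)))
             (∑-linear N .scale (H n) g₃) ⟩
      2ℚ * (1ℚ * ∑ N g₁ + ∑ N g₂ + H n * ∑ N g₃) + ∑ N g₄ ∎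

    pointwise : ∀ m → 1 ≤ m → m ≤ N →
      f₁ m - f₂ m + f₃ m + f₄ m ≡ 2ℚ * (1ℚ * g₁ m + g₂ m + H n * g₃ m) + g₄ m
    pointwise m 1≤m m≤N = begin
      f₁ m - f₂ m + f₃ m + f₄ m
        ≡⟨ regroup (x^k m) (lt n m) (extendChain m ks ψ) (ytildeChain m ks ψ) (C m)
             (∑ N (λ l → α n l * lt l m)) (∑ N (λ l → lt n l * β l m)) ⟩
      x^k m * (lt n m * (ytildeChain m ks ψ + extendChain m ks ψ)
               + (∑ N (λ l → α n l * lt l m) - ∑ N (λ l → lt n l * β l m)) * C m)
        -- The induction hypothesis brings 2 `H m` and the gap -2 (`H m - invN m - H n`). What
        -- survives is 2 `H n`, the new potential, and 2 `invN m`, which raises the exponent of m.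
        ≡⟨ cong₂ (λ q r → x^k m * (lt n m * q + r * C m))
             (ytildeChain-extendChain m ks ψ ks≥1) (∑-α-β n m 1≤m m≤N) ⟩
      x^k m * (lt n m * (2ℚ * (incChain m ks ψ + H m * C m) + chain m ks (moveLast ψ))
               + - 2ℚ * (lt n m * (H m - invN m - H n)) * C m)
        ≡⟨ collect (x^k m) (lt n m) (incChain m ks ψ) (C m) (chain m ks (moveLast ψ)) (H m) (invN m) (H n) ⟩
      2ℚ * (1ℚ * g₁ m + g₂ m + H n * g₃ m) + g₄ m ∎
      where
      regroup : ∀ w t X Y c a b → w * (t * X) - w * (b * c) + w * (t * Y) + w * (a * c)
                                ≡ w * (t * (Y + X) + (a - b) * c)
      regroup = solve-∀ ℚ-ring
      collect : ∀ w t I c B h i h′ →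
        w * (t * ((1ℚ + 1ℚ) * (I + h * c) + B) + - (1ℚ + 1ℚ) * (t * (h - i - h′)) * c)
          ≡ (1ℚ + 1ℚ) * (1ℚ * (i * w * (t * c)) + w * (t * I) + h′ * (w * (t * c))) + w * (t * B)
      collect = solve-∀ ℚ-ring

  comm-moved : ∀ {A : Set} {Λ : (A → ℚ) → ℚ} → Linear Λ → ∀ w r n (f : ℕ → A → ℚ) →
    Λ (λ a → moved w r n (λ m → f m a)) ≡ moved w r n (λ m → Λ (f m))
  comm-moved {Λ = Λ} Λ-lin w r n f = begin
    Λ (λ a → ∑ N (λ m → w m * f m a) - r * f n a)
      ≡⟨ sub Λ-lin (λ a → ∑ N (λ m → w m * f m a)) (λ a → r * f n a) ⟩
    Λ (λ a → ∑ N (λ m → w m * f m a)) - Λ (λ a → r * f n a)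
      ≡⟨ cong₂ _-_ (trans (comm-∑ Λ-lin N (λ m a → w m * f m a))
                          (∑-linear N .ext (λ m → Λ-lin .scale (w m) (f m))))
                   (Λ-lin .scale r (f n)) ⟩
    moved w r n (λ m → Λ (f m)) ∎

  -- The minus sign is the one in front of `β` in `pair-kernel`.
  moveSlot : (ℕ × ℕ → ℚ) → ℕ × ℕ → ℚ
  moveSlot φ (a , b) = moveLast (λ b′ → φ (a , b′)) b - moveFirst (λ a′ → φ (a′ , b)) a

  comm-moveSlot : ∀ {A : Set} {Λ : (A → ℚ) → ℚ} → Linear Λ → (f : ℕ × ℕ → A → ℚ) → ∀ ab →
    Λ (λ s → moveSlot (λ p → f p s) ab) ≡ moveSlot (λ p → Λ (f p)) ab
  comm-moveSlot Λ-lin f (a , b) = trans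
    (sub Λ-lin (λ s → moveLast (λ b′ → f (a , b′) s) b) (λ s → moveFirst (λ a′ → f (a′ , b) s) a))
    (cong₂ _-_ (comm-moved Λ-lin (α b) (2ℚ * H b) b (λ b′ → f (a , b′)))
               (comm-moved Λ-lin (λ l → β l a) (2ℚ * (H a - invN a)) a (λ a′ → f (a′ , b))))

  comm-slot-∷ : ∀ (L : Lin (List ℕ)) k φ →
    ⟪ L ⟫ (λ u → slot (k ∷ u) φ)
      ≡ ∑ N (λ m → powQ (invN m) k * ⟪ L ⟫ (λ u → chain m u (λ b → φ (m , b))))
  comm-slot-∷ L k φ = trans
    (comm-∑ (⟪⟫-linear L) N (λ m u → powQ (invN m) k * chain m u (λ b → φ (m , b))))
    (∑-linear N .ext (λ m → ⟪⟫-linear L .scale (powQ (invN m) k) (λ u → chain m u (λ b → φ (m , b)))))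

  -- The head index has no lower neighbour in its slot, so the insertions below it close no gap and
  -- remain as `moveFirst`.
  slot-ytilde : ∀ ks φ → ks ≢ [] → All (1 ≤_) ks →
    ⟪ ytildeIndices ks ⟫ (λ u → slot u φ)
      ≡ 2ℚ * ⟪ incIndices ks ⟫ (λ u → slot u φ) + slot ks (moveSlot φ)
  slot-ytilde []       φ ks≢[] _             = ⊥-elim (ks≢[] refl)
  slot-ytilde (k ∷ ks) φ _     (1≤k ∷ ks≥1) = begin
    ⟪ ytildeIndices (k ∷ ks) ⟫ (λ u → slot u φ)
      ≡⟨ trans (ytildeIndices-∷ k ks (λ u → slot u φ))
           (cong₂ _+_ (ytildePairs-∑ k (λ l m → chain m ks (λ b → φ (l , b))) 1≤k)
                      (comm-slot-∷ (ytildeIndices ks) k φ)) ⟩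
    ∑ N f₁ - ∑ N f₂ + ∑ N f₃
      ≡⟨ sym (trans (∑-linear N .add (λ m → f₁ m - f₂ m) f₃) (cong (_+ ∑ N f₃) (sub (∑-linear N) f₁ f₂))) ⟩
    ∑ N (λ m → f₁ m - f₂ m + f₃ m)
      ≡⟨ ∑-linear N .ext pointwise ⟩
    ∑ N (λ m → 2ℚ * (1ℚ * g₁ m + g₂ m) + g₃ m)
      ≡⟨ trans (∑-linear N .add (λ m → 2ℚ * (1ℚ * g₁ m + g₂ m)) g₃) (cong (_+ ∑ N g₃)
           (trans (∑-linear N .scale 2ℚ (λ m → 1ℚ * g₁ m + g₂ m)) (cong (2ℚ *_)
             (trans (∑-linear N .add (λ m → 1ℚ * g₁ m) g₂) (cong (_+ ∑ N g₂) (∑-linear N .scale 1ℚ g₁)))))) ⟩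
    2ℚ * (1ℚ * ∑ N g₁ + ∑ N g₂) + ∑ N g₃
      ≡⟨ cong (λ q → 2ℚ * q + ∑ N g₃) (sym (trans (incIndices-∷ k ks (λ u → slot u φ))
           (cong (_+_ (1ℚ * ∑ N g₁)) (comm-slot-∷ (incIndices ks) k φ)))) ⟩
    2ℚ * ⟪ incIndices (k ∷ ks) ⟫ (λ u → slot u φ) + slot (k ∷ ks) (moveSlot φ) ∎
    where
    x^k C S : ℕ → ℚ
    x^k m = powQ (invN m) k
    C m = chain m ks (λ b → φ (m , b))
    S m = ∑ N (λ l → β l m * chain m ks (λ b → φ (l , b)))
    f₁ f₂ f₃ g₁ g₂ g₃ : ℕ → ℚ
    f₁ m = x^k m * extendChain m ks (λ b → φ (m , b))
    f₂ m = x^k m * S m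
    f₃ m = x^k m * ytildeChain m ks (λ b → φ (m , b))
    g₁ m = invN m * x^k m * C m
    g₂ m = x^k m * incChain m ks (λ b → φ (m , b))
    g₃ m = x^k m * chain m ks (λ b → moveSlot φ (m , b))

    pointwise : ∀ m → f₁ m - f₂ m + f₃ m ≡ 2ℚ * (1ℚ * g₁ m + g₂ m) + g₃ m
    pointwise m = begin
      f₁ m - f₂ m + f₃ m
        ≡⟨ regroup (x^k m) (extendChain m ks φₘ) (S m) (ytildeChain m ks φₘ) ⟩
      x^k m * (ytildeChain m ks φₘ + extendChain m ks φₘ - S m)
        ≡⟨ cong (λ q → x^k m * (q - S m)) (ytildeChain-extendChain m ks φₘ ks≥1) ⟩
      x^k m * (2ℚ * (incChain m ks φₘ + H m * C m) + chain m ks (moveLast φₘ) - S m)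
        -- The 2 `H m` left over from the chain splits: 2 `invN m` raises the exponent of the head,
        -- and 2 (`H m - invN m`) goes into `moveFirst`.
        ≡⟨ collect (x^k m) (incChain m ks φₘ) (H m) (invN m) (C m) (chain m ks (moveLast φₘ)) (S m) ⟩
      2ℚ * (1ℚ * g₁ m + g₂ m) + x^k m * (chain m ks (moveLast φₘ) - (S m - 2ℚ * (H m - invN m) * C m))
        ≡⟨ cong (λ q → 2ℚ * (1ℚ * g₁ m + g₂ m) + x^k m * q) (sym split) ⟩
      2ℚ * (1ℚ * g₁ m + g₂ m) + g₃ m ∎
      where
      φₘ : ℕ → ℚ
      φₘ b = φ (m , b)
      regroup : ∀ w X s Y → w * X - w * s + w * Y ≡ w * (Y + X - s)
      regroup = solve-∀ ℚ-ring
      collect : ∀ w I h i c B s → w * ((1ℚ + 1ℚ) * (I + h * c) + B - s)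
        ≡ (1ℚ + 1ℚ) * (1ℚ * (i * w * c) + w * I) + w * (B - (s - (1ℚ + 1ℚ) * (h - i) * c))
      collect = solve-∀ ℚ-ring
      split : chain m ks (λ b → moveSlot φ (m , b))
            ≡ chain m ks (moveLast φₘ) - (S m - 2ℚ * (H m - invN m) * C m)
      split = trans
        (sub (chain-linear m ks) (moveLast φₘ) (λ b → moveFirst (λ a → φ (a , b)) m))
        (cong (_-_ (chain m ks (moveLast φₘ)))
          (comm-moved (chain-linear m ks) (λ l → β l m) (2ℚ * (H m - invN m)) m (λ a b → φ (a , b))))

  -- Several slots

  tuples : List (List ℕ) → (List (ℕ × ℕ) → ℚ) → ℚ
  tuples []         F = F []
  tuples (ks ∷ kss) F = slot ks (λ ab → tuples kss (λ ps → F (ab ∷ ps)))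

  tuples-linear : ∀ kss → Linear (tuples kss)
  tuples-linear []         = eval-linear []
  tuples-linear (ks ∷ kss) = bind-linear (slot-linear ks) (λ ab →
    bind-linear (tuples-linear kss) (λ ps → eval-linear (ab ∷ ps)))

  moveAny : (List (ℕ × ℕ) → ℚ) → List (ℕ × ℕ) → ℚ
  moveAny F []        = 0ℚ
  moveAny F (ab ∷ ps) = moveSlot (λ p → F (p ∷ ps)) ab + moveAny (λ qs → F (ab ∷ qs)) ps

  -- A Leibniz rule over the slots. F must be arbitrary, because fixing the ends of the first slot
  -- turns it into another function for the remaining ones.
  tuples-ytilde : ∀ kss F → All (λ ks → ks ≢ []) kss → All (All (1 ≤_)) kss →
    ⟪ slotwise ytildeIndices kss ⟫ (λ t → tuples t F)
      ≡ 2ℚ * ⟪ slotwise incIndices kss ⟫ (λ t → tuples t F) + tuples kss (moveAny F)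
  tuples-ytilde []         F []             []              = refl
  tuples-ytilde (ks ∷ kss) F (ks≢[] ∷ kss≢) (ks≥1 ∷ kss≥1) = begin
    ⟪ slotwise ytildeIndices (ks ∷ kss) ⟫ (λ t → tuples t F)
      ≡⟨ slotwise-∷ ytildeIndices ks kss (λ t → tuples t F) ⟩
    ⟪ ytildeIndices ks ⟫ (λ u → slot u φ) + ⟪ slotwise ytildeIndices kss ⟫ (λ t → slot ks (λ ab → tuples t (λ ps → F (ab ∷ ps))))
      ≡⟨ cong₂ _+_ (slot-ytilde ks φ ks≢[] ks≥1)
           (trans (sym (comm-⟪⟫ (slot-linear ks) (slotwise ytildeIndices kss) (λ t ab → tuples t (λ ps → F (ab ∷ ps)))))
             (slot-linear ks .ext (λ ab → tuples-ytilde kss (λ ps → F (ab ∷ ps)) kss≢ kss≥1))) ⟩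
    2ℚ * A + slot ks (moveSlot φ) + slot ks (λ ab → 2ℚ * inner ab + tuples kss (moveAny (λ ps → F (ab ∷ ps))))
      ≡⟨ cong₂ (λ q r → 2ℚ * A + q + r)
           -- The move in the first slot passes through the sums over the other slots by their
           -- linearity.
           (slot-linear ks .ext (λ ab → sym (comm-moveSlot (tuples-linear kss) (λ p ps → F (p ∷ ps)) ab)))
           (trans (slot-linear ks .add (λ ab → 2ℚ * inner ab) E₂)
             (cong (_+ slot ks E₂) (trans (slot-linear ks .scale 2ℚ inner)
               (cong (2ℚ *_) (comm-⟪⟫ (slot-linear ks) (slotwise incIndices kss) (λ t ab → tuples t (λ ps → F (ab ∷ ps)))))))) ⟩
    2ℚ * A + slot ks E₁ + (2ℚ * B + slot ks E₂)
      ≡⟨ regroup A (slot ks E₁) B (slot ks E₂) ⟩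
    2ℚ * (A + B) + (slot ks E₁ + slot ks E₂)
      ≡⟨ cong₂ (λ q r → 2ℚ * q + r) (sym (slotwise-∷ incIndices ks kss (λ t → tuples t F)))
           (trans (sym (slot-linear ks .add E₁ E₂))
             (slot-linear ks .ext (λ ab → sym (tuples-linear kss .add
               (λ ps → moveSlot (λ p → F (p ∷ ps)) ab) (moveAny (λ ps → F (ab ∷ ps))))))) ⟩
    2ℚ * ⟪ slotwise incIndices (ks ∷ kss) ⟫ (λ t → tuples t F) + tuples (ks ∷ kss) (moveAny F) ∎
    where
    φ inner E₁ E₂ : ℕ × ℕ → ℚ
    φ ab = tuples kss (λ ps → F (ab ∷ ps))
    inner ab = ⟪ slotwise incIndices kss ⟫ (λ t → tuples t (λ ps → F (ab ∷ ps)))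
    E₁ ab = tuples kss (λ ps → moveSlot (λ p → F (p ∷ ps)) ab)
    E₂ ab = tuples kss (moveAny (λ ps → F (ab ∷ ps)))
    A B : ℚ
    A = ⟪ incIndices ks ⟫ (λ u → slot u φ)
    B = ⟪ slotwise incIndices kss ⟫ (λ t → slot ks (λ ab → tuples t (λ ps → F (ab ∷ ps))))
    regroup : ∀ a e b f → (1ℚ + 1ℚ) * a + e + ((1ℚ + 1ℚ) * b + f) ≡ (1ℚ + 1ℚ) * (a + b) + (e + f)
    regroup = solve-∀ ℚ-ring

-- The cyclic condition

-- The cycle cut open at its first slot: a is the current first index, and e is the last index of
-- the initial slot, with which the path closes.
path : ℕ → List (ℕ × ℕ) → ℕ → ℚ
path a []               e = le a e
path a ((a′ , b) ∷ ps) e = le a b * path a′ ps e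

cyclic : List (ℕ × ℕ) → ℚ
cyclic []             = 1ℚ
cyclic ((a , b) ∷ ps) = path a ps b

lt-absorb : ∀ {c d} m q → c ≤ d → lt d m * (lt c m * q) ≡ lt d m * q
lt-absorb {c} {d} m q c≤d with ℕP.<-≤-connex d m
... | inj₁ d<m = cong (lt d m *_) (*-identityˡ-≡ q (lt-yes (ℕP.≤-<-trans c≤d d<m)))
... | inj₂ m≤d = trans (*-zeroˡ-≡ (lt c m * q) (lt-no m≤d)) (sym (*-zeroˡ-≡ q (lt-no m≤d)))

-- Moving b up and moving a down across the condition a ≤ b leaves a quantity depending on b only.
edge : ∀ N a b → 1 ≤ a → a ≤ N → b ≤ N →
  moveLast N (le a) b - moveFirst N (λ a′ → le a′ b) a ≡ H (N ∸ b) - H N - H b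
-- With the first index written as a successor, `le (suc a) m` computes to `lt a m`, and its
-- harmonic term `H (suc a) - invN (suc a)` is `H a`.
edge N (suc a) b _ a<N b≤N = trans (cong₂ (λ q r → q - 2ℚ * H b * le (suc a) b - (r - 2ℚ * (H (suc a) - invN (suc a)) * le (suc a) b)) upper lower) cases
  where
  a≤N : a ≤ N
  a≤N = ℕP.<⇒≤ a<N
  W₁ V W₂ : ℚ
  W₁ = ∑ N (λ m → lt a m * (lt b m * invN m))
  V  = ∑ b (λ l → invN (suc a ∸ l))
  W₂ = ∑ b (λ l → le l a * invN l)

  ring₁ : ∀ i t j s → (i - t * j) * s ≡ s * i - s * (t * j)
  ring₁ = solve-∀ ℚ-ring
  ring₂ : ∀ i t j s → (i + t * j) * s ≡ s * i + s * (t * j)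
  ring₂ = solve-∀ ℚ-ring

  upper : ∑ N (λ m → α b m * lt a m) ≡ H (N ∸ b) - H (a ∸ b) - W₁
  upper = begin
    ∑ N (λ m → α b m * lt a m)
      ≡⟨ ∑-linear N .ext (λ m → ring₁ (invN (m ∸ b)) (lt b m) (invN m) (lt a m)) ⟩
    ∑ N (λ m → lt a m * invN (m ∸ b) - lt a m * (lt b m * invN m))
      ≡⟨ sub (∑-linear N) (λ m → lt a m * invN (m ∸ b)) (λ m → lt a m * (lt b m * invN m)) ⟩
    ∑ N (λ m → lt a m * invN (m ∸ b)) - W₁
      ≡⟨ cong (_- W₁) (trans (∑-lt a≤N (λ m → invN (m ∸ b)))
                             (cong₂ _-_ (∑-inv-shift b N) (∑-inv-shift b a))) ⟩
    H (N ∸ b) - H (a ∸ b) - W₁ ∎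

  lower : ∑ N (λ l → β l (suc a) * le l b) ≡ V + W₂
  lower = begin
    ∑ N (λ l → β l (suc a) * le l b)
      ≡⟨ ∑-linear N .ext (λ l → ring₂ (invN (suc a ∸ l)) (lt l (suc a)) (invN l) (le l b)) ⟩
    ∑ N (λ l → le l b * invN (suc a ∸ l) + le l b * (lt l (suc a) * invN l))
      ≡⟨ ∑-linear N .add (λ l → le l b * invN (suc a ∸ l)) (λ l → le l b * (lt l (suc a) * invN l)) ⟩
    ∑ N (λ l → le l b * invN (suc a ∸ l)) + ∑ N (λ l → le l b * (lt l (suc a) * invN l))
      ≡⟨ cong₂ _+_ (∑-le b≤N (λ l → invN (suc a ∸ l)))
           (trans (∑-le b≤N (λ l → lt l (suc a) * invN l))
                  (∑-linear b .ext (λ l → cong (_* invN l) (lt-suc l a)))) ⟩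
    V + W₂ ∎

  ring₃ : ∀ {t W₁ V W₂} P Q HN Ha Hb i → t ≡ 0ℚ → W₁ ≡ HN - Ha → V ≡ Ha - Q → W₂ ≡ Hb →
    P - Q - W₁ - (1ℚ + 1ℚ) * Hb * t - (V + W₂ - (1ℚ + 1ℚ) * (Ha + i - i) * t) ≡ P - HN - Hb
  ring₃ P Q HN Ha Hb i refl refl refl refl = go P Q HN Ha Hb i
    where
    go : ∀ P Q HN Ha Hb i → P - Q - (HN - Ha) - (1ℚ + 1ℚ) * Hb * 0ℚ - (Ha - Q + Hb - (1ℚ + 1ℚ) * (Ha + i - i) * 0ℚ)
                      ≡ P - HN - Hb
    go = solve-∀ ℚ-ring
  ring₄ : ∀ {t Q W₁ V W₂} P HN Ha Hb i → t ≡ 1ℚ → Q ≡ 0ℚ → W₁ ≡ HN - Hb → V ≡ Ha → W₂ ≡ Ha →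
    P - Q - W₁ - (1ℚ + 1ℚ) * Hb * t - (V + W₂ - (1ℚ + 1ℚ) * (Ha + i - i) * t) ≡ P - HN - Hb
  ring₄ P HN Ha Hb i refl refl refl refl refl = go P HN Ha Hb i
    where
    go : ∀ P HN Ha Hb i → P - 0ℚ - (HN - Hb) - (1ℚ + 1ℚ) * Hb * 1ℚ - (Ha + Ha - (1ℚ + 1ℚ) * (Ha + i - i) * 1ℚ)
                      ≡ P - HN - Hb
    go = solve-∀ ℚ-ring

  cases : H (N ∸ b) - H (a ∸ b) - W₁ - 2ℚ * H b * le (suc a) b
            - (V + W₂ - 2ℚ * (H (suc a) - invN (suc a)) * le (suc a) b)
        ≡ H (N ∸ b) - H N - H b
  cases with ℕP.<-≤-connex a b
  -- The condition fails: both old values are 0, and `H (a ∸ b)` occurs in the upper and the lower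
  -- insertions and cancels.
  ... | inj₂ b≤a = ring₃ (H (N ∸ b)) (H (a ∸ b)) (H N) (H a) (H b) (invN (suc a)) (lt-no b≤a)
    (trans (∑-linear N .ext (λ m → lt-absorb m (invN m) b≤a)) (∑-lt a≤N invN))
    (∑-inv-top b≤a) (∑-le-all b≤a invN)
  -- The condition holds: `H (a ∸ b)` is 0, and the lower insertions, worth 2 `H a`, cancel against
  -- the old value subtracted in `moveFirst`.
  ... | inj₁ a<b = ring₄ (H (N ∸ b)) (H N) (H a) (H b) (invN (suc a)) (lt-yes a<b)
    (cong H (ℕP.m≤n⇒m∸n≡0 (ℕP.<⇒≤ a<b)))
    (trans (∑-linear N .ext (λ m → trans (swap (lt a m) (lt b m) (invN m)) (lt-absorb m (invN m) (ℕP.<⇒≤ a<b))))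
           (∑-lt b≤N invN))
    (∑-inv-top-all (ℕP.<⇒≤ a<b)) (∑-le (ℕP.<⇒≤ a<b) invN)
    where
    swap : ∀ s t q → s * (t * q) ≡ t * (s * q)
    swap = solve-∀ ℚ-ring

-- Regrouping the insertions by the inequalities of the cycle

module _ (N : ℕ) where

  moved-*ˡ : ∀ w r n q χ → moved N w r n (λ m → q * χ m) ≡ q * moved N w r n χ
  -- Multiplication by q is viewed as a linear functional on functions of a one-point type.
  moved-*ˡ w r n q χ = sym (comm-moved N (scale-linear q (eval-linear tt)) w r n (λ m _ → χ m))

  moved-*ʳ : ∀ w r n q χ → moved N w r n (λ m → χ m * q) ≡ moved N w r n χ * q
  moved-*ʳ w r n q χ = begin
    ∑ N (λ m → w m * (χ m * q)) - r * (χ n * q)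
      ≡⟨ cong₂ _-_ (∑-linear N .ext (λ m → sym (ℚP.*-assoc (w m) (χ m) q))) (sym (ℚP.*-assoc r (χ n) q)) ⟩
    ∑ N (λ m → w m * χ m * q) - r * χ n * q
      ≡⟨ cong (_- r * χ n * q) (scaleʳ (∑-linear N) (λ m → w m * χ m) q) ⟩
    ∑ N (λ m → w m * χ m) * q - r * χ n * q
      ≡⟨ factor (∑ N (λ m → w m * χ m)) (r * χ n) q ⟩
    moved N w r n χ * q ∎
    where
    factor : ∀ a b c → a * c - b * c ≡ (a - b) * c
    factor = solve-∀ ℚ-ring

  moveAny-* : ∀ q F ps → moveAny N (λ qs → q * F qs) ps ≡ q * moveAny N F ps
  moveAny-* q F []        = sym (ℚP.*-zeroʳ q)
  moveAny-* q F (ab ∷ ps) = trans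
    (cong₂ _+_ (sym (comm-moveSlot N (scale-linear q (eval-linear tt)) (λ p _ → F (p ∷ ps)) ab))
               (moveAny-* q (λ qs → F (ab ∷ qs)) ps))
    (sym (ℚP.*-distribˡ-+ q (moveSlot N (λ p → F (p ∷ ps)) ab) (moveAny N (λ qs → F (ab ∷ qs)) ps)))

  -- This is what `moveAny N cyclic` unfolds to at `(a , b) ∷ ps`; in this form a and b may also
  -- come from different slots, as the recursion along the path requires.
  movePath : ℕ → List (ℕ × ℕ) → ℕ → ℚ
  movePath a ps b =
    moveLast N (path a ps) b - moveFirst N (λ a′ → path a′ ps b) a + moveAny N (λ qs → path a qs b) ps

  -- Among the factors of the path, a and b′ occur only in `le a b′`. Their two moves, which come
  -- from different slots, therefore combine to the quantity of `edge`, and all other moves act on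
  -- the shorter path.
  movePath-∷ : ∀ a a′ b′ ps b → movePath a ((a′ , b′) ∷ ps) b ≡
    (moveLast N (le a) b′ - moveFirst N (λ a″ → le a″ b′) a) * path a′ ps b + le a b′ * movePath a′ ps b
  movePath-∷ a a′ b′ ps b = trans
    (cong₂ _+_
      (cong₂ _-_ (moved-*ˡ (α b) (2ℚ * H b) b (le a b′) (path a′ ps))
                 (moved-*ʳ (λ l → β l a) (2ℚ * (H a - invN a)) a (path a′ ps b) (λ a″ → le a″ b′)))
      (cong₂ _+_
        (cong₂ _-_ (moved-*ʳ (α b′) (2ℚ * H b′) b′ (path a′ ps b) (le a))
                   (moved-*ˡ (λ l → β l a′) (2ℚ * (H a′ - invN a′)) a′ (le a b′) (λ a″ → path a″ ps b)))
        (moveAny-* (le a b′) (λ qs → path a′ qs b) ps)))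
    (regroup (le a b′) (path a′ ps b) (moveLast N (path a′ ps) b) (moveFirst N (λ a″ → le a″ b′) a)
      (moveLast N (le a) b′) (moveFirst N (λ a″ → path a″ ps b) a′) (moveAny N (λ qs → path a′ qs b) ps))
    where
    regroup : ∀ t P B A B′ A′ M →
      t * B - A * P + (B′ * P - t * A′ + t * M) ≡ (B′ - A) * P + t * (B - A′ + M)
    regroup = solve-∀ ℚ-ring

-- Rationals q with q ∈ r ℤ₍ₚ₎

module Localization {p : ℕ} (p-prime : Prime p) where

  -- The equation is cross-multiplied and the fraction need not be in lowest terms, so sums and
  -- products require no reduction. The case r = 1 is p-integrality, and r = p is divisibility by p.
  record Multiple (r : ℤ) (q : ℚ) : Set where
    field
      den num : ℤ
      p∤den   : p ∤ ℤ.∣ den ∣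
      eq      : q * ι den ≡ ι r * ι num

  open Multiple

  p∤1 : p ∤ 1
  p∤1 p∣1 with refl ← ∣1⇒≡1 p∣1 = ¬prime[1] p-prime

  p∤* : ∀ i j → p ∤ ℤ.∣ i ∣ → p ∤ ℤ.∣ j ∣ → p ∤ ℤ.∣ i ℤ.* j ∣
  p∤* i j p∤i p∤j p∣ij with euclidsLemma ℤ.∣ i ∣ ℤ.∣ j ∣ p-prime (subst (p ∣_) (ℤP.abs-* i j) p∣ij)
  ... | inj₁ p∣i = p∤i p∣i
  ... | inj₂ p∣j = p∤j p∣j

  multiple-0 : ∀ {r} → Multiple r 0ℚ
  multiple-0 {r} = record
    { den = ℤ.1ℤ ; num = ℤ.0ℤ ; p∤den = p∤1
    ; eq = trans (ℚP.*-zeroˡ (ι ℤ.1ℤ)) (sym (ℚP.*-zeroʳ (ι r))) }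

  integral-ι : ∀ i → Multiple ℤ.1ℤ (ι i)
  integral-ι i = record { den = ℤ.1ℤ ; num = i ; p∤den = p∤1 ; eq = ℚP.*-comm (ι i) (ι ℤ.1ℤ) }

  multiple-+ : ∀ {r q s} → Multiple r q → Multiple r s → Multiple r (q + s)
  multiple-+ {r} {q} {s} Q S = record
    { den = den Q ℤ.* den S ; num = num Q ℤ.* den S ℤ.+ num S ℤ.* den Q
    ; p∤den = p∤* (den Q) (den S) (p∤den Q) (p∤den S)
    ; eq = begin
        (q + s) * ι (den Q ℤ.* den S)
          ≡⟨ cong ((q + s) *_) (ι-* (den Q) (den S)) ⟩
        (q + s) * (ι (den Q) * ι (den S))
          ≡⟨ expand q s (ι (den Q)) (ι (den S)) ⟩
        q * ι (den Q) * ι (den S) + s * ι (den S) * ι (den Q)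
          ≡⟨ cong₂ (λ t u → t * ι (den S) + u * ι (den Q)) (eq Q) (eq S) ⟩
        ι r * ι (num Q) * ι (den S) + ι r * ι (num S) * ι (den Q)
          ≡⟨ factor (ι r) (ι (num Q)) (ι (den S)) (ι (num S)) (ι (den Q)) ⟩
        ι r * (ι (num Q) * ι (den S) + ι (num S) * ι (den Q))
          ≡⟨ cong (ι r *_) (sym (trans (ι-+ (num Q ℤ.* den S) (num S ℤ.* den Q))
               (cong₂ _+_ (ι-* (num Q) (den S)) (ι-* (num S) (den Q))))) ⟩
        ι r * ι (num Q ℤ.* den S ℤ.+ num S ℤ.* den Q) ∎ }
    where
    expand : ∀ q s d e → (q + s) * (d * e) ≡ q * d * e + s * e * d
    expand = solve-∀ ℚ-ring
    factor : ∀ r a b c d → r * a * b + r * c * d ≡ r * (a * b + c * d)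
    factor = solve-∀ ℚ-ring

  multiple-* : ∀ {r q s} → Multiple ℤ.1ℤ q → Multiple r s → Multiple r (q * s)
  multiple-* {r} {q} {s} Q S = record
    { den = den Q ℤ.* den S ; num = num Q ℤ.* num S
    ; p∤den = p∤* (den Q) (den S) (p∤den Q) (p∤den S)
    ; eq = begin
        q * s * ι (den Q ℤ.* den S)              ≡⟨ cong (q * s *_) (ι-* (den Q) (den S)) ⟩
        q * s * (ι (den Q) * ι (den S))          ≡⟨ interchange q s (ι (den Q)) (ι (den S)) ⟩
        q * ι (den Q) * (s * ι (den S))          ≡⟨ cong₂ _*_ (eq Q) (eq S) ⟩
        ι ℤ.1ℤ * ι (num Q) * (ι r * ι (num S))   ≡⟨ collect (ι (num Q)) (ι r) (ι (num S)) ⟩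
        ι r * (ι (num Q) * ι (num S))            ≡⟨ cong (ι r *_) (sym (ι-* (num Q) (num S))) ⟩
        ι r * ι (num Q ℤ.* num S)                ∎ }
    where
    interchange : ∀ a b c d → a * b * (c * d) ≡ a * c * (b * d)
    interchange = solve-∀ ℚ-ring
    collect : ∀ a b c → 1ℚ * a * (b * c) ≡ b * (a * c)
    collect = solve-∀ ℚ-ring

  integral-inv : ∀ n → 1 ≤ n → n < p → Multiple ℤ.1ℤ (invN n)
  integral-inv n@(suc _) 1≤n n<p = record
    { den = ℤ.+ n ; num = ℤ.1ℤ ; p∤den = >⇒∤ n<p ; eq = inv-ι n 1≤n }

  integral-pow : ∀ {q} → Multiple ℤ.1ℤ q → ∀ k → Multiple ℤ.1ℤ (powQ q k)
  integral-pow Q zero    = integral-ι ℤ.1ℤ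
  integral-pow Q (suc k) = multiple-* Q (integral-pow Q k)

  integral-lt : ∀ a b → Multiple ℤ.1ℤ (lt a b)
  integral-lt a b with a <ᵇ b
  ... | true  = integral-ι ℤ.1ℤ
  ... | false = integral-ι ℤ.0ℤ

  integral-le : ∀ a b → Multiple ℤ.1ℤ (le a b)
  integral-le a b = subst (Multiple ℤ.1ℤ) (lt-suc a b) (integral-lt a (suc b))

  multiple-∑ : ∀ {r} M {f} → (∀ n → 1 ≤ n → n ≤ M → Multiple r (f n)) → Multiple r (∑ M f)
  multiple-∑ zero    h = multiple-0
  multiple-∑ (suc M) h = multiple-+ (multiple-∑ M (λ n 1≤n n≤M → h n 1≤n (ℕP.m≤n⇒m≤1+n n≤M)))
                                    (h (suc M) (s≤s z≤n) ℕP.≤-refl)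

  -- Clearing denominators shows that p divides the product of the reduced numerator and `den Q`;
  -- Euclid's lemma leaves only the numerator.
  multiple⇒∣ : ∀ {q} → Multiple (ℤ.+ p) q → p ∣ ℤ.∣ ↥ q ∣
  multiple⇒∣ {q@record{}} Q with euclidsLemma ℤ.∣ ↥ q ∣ ℤ.∣ den Q ∣ p-prime p∣
    where
    cleared-≃ : toℚᵘ q ℚᵘ.* mkℚᵘ (den Q) 0 ℚᵘ.≃ mkℚᵘ (ℤ.+ p ℤ.* num Q) 0
    cleared-≃ = ℚᵘP.≃-trans (ℚᵘP.*-congˡ {toℚᵘ q} (ℚᵘP.≃-sym (ℚP.toℚᵘ-fromℚᵘ (mkℚᵘ (den Q) 0))))
      (ℚᵘP.≃-trans (ℚᵘP.≃-sym (ℚP.toℚᵘ-homo-* q (ι (den Q))))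
        (ℚᵘP.≃-trans (ℚP.toℚᵘ-cong (trans (eq Q) (sym (ι-* (ℤ.+ p) (num Q)))))
          (ℚP.toℚᵘ-fromℚᵘ (mkℚᵘ (ℤ.+ p ℤ.* num Q) 0))))
    cleared : ↥ q ℤ.* den Q ≡ ℤ.+ p ℤ.* num Q ℤ.* ↧ q
    cleared with ℚᵘ.*≡* e ← cleared-≃ = begin
      ↥ q ℤ.* den Q                                  ≡⟨ sym (ℤP.*-identityʳ (↥ q ℤ.* den Q)) ⟩
      ↥ q ℤ.* den Q ℤ.* ℤ.1ℤ                         ≡⟨ e ⟩
      ℤ.+ p ℤ.* num Q ℤ.* (ℤ.+ (↧ₙ q ℕ.* 1))         ≡⟨ cong (λ d → ℤ.+ p ℤ.* num Q ℤ.* (ℤ.+ d)) (ℕP.*-identityʳ (↧ₙ q)) ⟩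
      ℤ.+ p ℤ.* num Q ℤ.* ↧ q                        ∎
    p∣ : p ∣ ℤ.∣ ↥ q ∣ ℕ.* ℤ.∣ den Q ∣
    p∣ = subst (p ∣_) (ℤP.abs-* (↥ q) (den Q)) (subst (λ i → p ∣ ℤ.∣ i ∣) (sym cleared)
      (subst (p ∣_) (sym (trans (ℤP.abs-* (ℤ.+ p ℤ.* num Q) (↧ q)) (cong (ℕ._* ℤ.∣ ↧ q ∣) (ℤP.abs-* (ℤ.+ p) (num Q)))))
        (∣m⇒∣m*n ℤ.∣ ↧ q ∣ (m∣m*n ℤ.∣ num Q ∣))))
  ... | inj₁ p∣q = p∣q
  ... | inj₂ p∣d = ⊥-elim (p∤den Q p∣d)

-- Divisibility of the remainder by p = N + 1

module CyclicSum {N : ℕ} (p-prime : Prime (suc N)) where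

  open Localization p-prime

  Range : ℕ → Set
  Range n = 1 ≤ n × n ≤ N

  Range² : ℕ × ℕ → Set
  Range² (a , b) = Range a × Range b

  integral-inv-N : ∀ {n} → 1 ≤ n → n ≤ N → Multiple ℤ.1ℤ (invN n)
  integral-inv-N {n} 1≤n n≤N = integral-inv n 1≤n (s≤s n≤N)

  -- All summation indices lie in 1, ..., p - 1, so the weights are p-integral and divisibility of ψ
  -- at each index is inherited by the sum.
  multiple-chain : ∀ {r n ψ} ks → Range n → (∀ b → Range b → Multiple r (ψ b)) → Multiple r (chain N n ks ψ)
  multiple-chain          []       n∈ h = h _ n∈
  multiple-chain {n = n} (k ∷ ks) n∈ h = multiple-∑ N (λ m 1≤m m≤N →
    multiple-* (integral-pow (integral-inv-N 1≤m m≤N) k)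
      (multiple-* (integral-lt n m) (multiple-chain ks (1≤m , m≤N) h)))

  -- An empty slot would evaluate φ at (0 , 0), outside the range in which φ is controlled.
  multiple-slot : ∀ {r φ} ks → ks ≢ [] → (∀ ab → Range² ab → Multiple r (φ ab)) → Multiple r (slot N ks φ)
  multiple-slot []       ks≢[] h = ⊥-elim (ks≢[] refl)
  multiple-slot (k ∷ ks) _     h = multiple-∑ N (λ m 1≤m m≤N →
    multiple-* (integral-pow (integral-inv-N 1≤m m≤N) k)
      (multiple-chain ks (1≤m , m≤N) (λ b b∈ → h (m , b) ((1≤m , m≤N) , b∈))))

  multiple-tuples : ∀ {r F} kss → All (λ ks → ks ≢ []) kss →
    (∀ ps → All Range² ps → Multiple r (F ps)) → Multiple r (tuples N kss F)
  multiple-tuples []         []             h = h [] []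
  multiple-tuples (ks ∷ kss) (ks≢[] ∷ kss≢) h = multiple-slot ks ks≢[] (λ ab ab∈ →
    multiple-tuples kss kss≢ (λ ps ps∈ → h (ab ∷ ps) (ab∈ ∷ ps∈)))

  integral-path : ∀ a ps b → Multiple ℤ.1ℤ (path a ps b)
  integral-path a []               b = integral-le a b
  integral-path a ((a′ , b′) ∷ ps) b = multiple-* (integral-le a b′) (integral-path a′ ps b)

  -- 1/(p − l) + 1/l = p / (l (p − l))
  p∣inv-pair : ∀ l → 1 ≤ l → l ≤ N → Multiple (ℤ.+ suc N) (invN (suc N ∸ l) + invN l)
  p∣inv-pair l 1≤l l≤N = record
    { den = ℤ.+ l ℤ.* (ℤ.+ l′) ; num = ℤ.1ℤ
    ; p∤den = p∤* (ℤ.+ l) (ℤ.+ l′) (>⇒∤ (s≤s l≤N)) (>⇒∤ (s≤s (ℕP.∸-monoʳ-≤ (suc N) 1≤l)))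
    ; eq = begin
        (invN l′ + invN l) * ι (ℤ.+ l ℤ.* (ℤ.+ l′))
          ≡⟨ cong ((invN l′ + invN l) *_) (ι-* (ℤ.+ l) (ℤ.+ l′)) ⟩
        (invN l′ + invN l) * (ι (ℤ.+ l) * ι (ℤ.+ l′))
          ≡⟨ expand (invN l′) (invN l) (ι (ℤ.+ l)) (ι (ℤ.+ l′)) ⟩
        invN l′ * ι (ℤ.+ l′) * ι (ℤ.+ l) + invN l * ι (ℤ.+ l) * ι (ℤ.+ l′)
          ≡⟨ cong₂ _+_ (*-identityˡ-≡ (ι (ℤ.+ l)) (inv-ι l′ 1≤l′)) (*-identityˡ-≡ (ι (ℤ.+ l′)) (inv-ι l 1≤l)) ⟩
        ι (ℤ.+ l) + ι (ℤ.+ l′)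
          ≡⟨ sym (ι-∸ (ℕP.m≤n⇒m≤1+n l≤N)) ⟩
        ι (ℤ.+ suc N)
          ≡⟨ sym (ℚP.*-identityʳ (ι (ℤ.+ suc N))) ⟩
        ι (ℤ.+ suc N) * ι ℤ.1ℤ ∎ }
    where
    l′ : ℕ
    l′ = suc N ∸ l
    1≤l′ : 1 ≤ l′
    1≤l′ = ℕP.m<n⇒0<n∸m (s≤s l≤N)
    instance
      l-nonZero : ℕ.NonZero l
      l-nonZero = ℕ.>-nonZero 1≤l
      l′-nonZero : ℕ.NonZero l′
      l′-nonZero = ℕ.>-nonZero 1≤l′
    expand : ∀ a b c d → (a + b) * (c * d) ≡ a * d * c + b * c * d
    expand = solve-∀ ℚ-ring

  multiple-edge : ∀ a b → Range a → Range b →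
    Multiple (ℤ.+ suc N) (moveLast N (le a) b - moveFirst N (λ a′ → le a′ b) a)
  multiple-edge a b (1≤a , a≤N) (_ , b≤N) = subst (Multiple (ℤ.+ suc N)) (sym edge-∑)
    (multiple-* (integral-ι (ℤ.- ℤ.1ℤ)) (multiple-∑ b (λ l 1≤l l≤b → p∣inv-pair l 1≤l (ℕP.≤-trans l≤b b≤N))))
    where
    ring : ∀ P Q R → P - Q - R ≡ - 1ℚ * (Q - P + R)
    ring = solve-∀ ℚ-ring
    edge-∑ : moveLast N (le a) b - moveFirst N (λ a′ → le a′ b) a
           ≡ - 1ℚ * ∑ b (λ l → invN (suc N ∸ l) + invN l)
    edge-∑ = begin
      moveLast N (le a) b - moveFirst N (λ a′ → le a′ b) a
        ≡⟨ edge N a b 1≤a a≤N b≤N ⟩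
      H (N ∸ b) - H N - H b
        ≡⟨ ring (H (N ∸ b)) (H N) (H b) ⟩
      - 1ℚ * (H N - H (N ∸ b) + H b)
        ≡⟨ cong (λ q → - 1ℚ * (q + H b)) (sym (∑-inv-top b≤N)) ⟩
      - 1ℚ * (∑ b (λ l → invN (suc N ∸ l)) + H b)
        ≡⟨ cong (- 1ℚ *_) (sym (∑-linear b .add (λ l → invN (suc N ∸ l)) invN)) ⟩
      - 1ℚ * ∑ b (λ l → invN (suc N ∸ l) + invN l) ∎

  -- Each inequality contributes its `edge` error times the indicators of the others, which are
  -- p-integral.
  multiple-movePath : ∀ a ps b → Range a → All Range² ps → Range b →
    Multiple (ℤ.+ suc N) (movePath N a ps b)
  multiple-movePath a [] b a∈ [] b∈ = multiple-+ (multiple-edge a b a∈ b∈) multiple-0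
  multiple-movePath a ((a′ , b′) ∷ ps) b a∈ ((a′∈ , b′∈) ∷ ps∈) b∈ =
    subst (Multiple (ℤ.+ suc N)) (sym (movePath-∷ N a a′ b′ ps b))
      (multiple-+
        (subst (Multiple (ℤ.+ suc N)) (ℚP.*-comm (path a′ ps b) (moveLast N (le a) b′ - moveFirst N (λ a″ → le a″ b′) a))
          (multiple-* (integral-path a′ ps b) (multiple-edge a b′ a∈ b′∈)))
        (multiple-* (integral-le a b′) (multiple-movePath a′ ps b a′∈ ps∈ b∈)))

  multiple-cyclic : ∀ kss → kss ≢ [] → All (λ ks → ks ≢ []) kss →
    Multiple (ℤ.+ suc N) (tuples N kss (moveAny N cyclic))
  multiple-cyclic []         kss≢[] _              = ⊥-elim (kss≢[] refl)
  multiple-cyclic (ks ∷ kss) _      (ks≢[] ∷ kss≢) = multiple-slot ks ks≢[] (λ (a , b) (a∈ , b∈) →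
    multiple-tuples kss kss≢ (λ ps ps∈ → multiple-movePath a ps b a∈ ps∈ b∈))

-- Sums over lists

listSum : ∀ {A : Set} → List A → (A → ℚ) → ℚ
listSum xs f = sumQ (map f xs)

listSum-++ : ∀ {A : Set} (as bs : List A) f → listSum (as ++ bs) f ≡ listSum as f + listSum bs f
listSum-++ []       bs f = sym (ℚP.+-identityˡ (listSum bs f))
listSum-++ (a ∷ as) bs f =
  trans (cong (f a +_) (listSum-++ as bs f)) (sym (ℚP.+-assoc (f a) (listSum as f) (listSum bs f)))

listSum-map : ∀ {A B : Set} (h : A → B) as f → listSum (map h as) f ≡ listSum as (f ∘ h)
listSum-map h as f = cong sumQ (sym (ListP.map-∘ as))

listSum-concatMap : ∀ {A B : Set} (h : A → List B) as f →
  listSum (concatMap h as) f ≡ listSum as (λ a → listSum (h a) f)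
listSum-concatMap h []       f = refl
listSum-concatMap h (a ∷ as) f =
  trans (listSum-++ (h a) (concatMap h as) f) (cong (listSum (h a) f +_) (listSum-concatMap h as f))

listSum-cong : ∀ {A : Set} (as : List A) {f g : A → ℚ} → (∀ a → f a ≡ g a) → listSum as f ≡ listSum as g
listSum-cong as e = cong sumQ (ListP.map-cong e as)

listSum-*ˡ : ∀ {A : Set} r (as : List A) f → listSum as (λ a → r * f a) ≡ r * listSum as f
listSum-*ˡ r []       f = sym (ℚP.*-zeroʳ r)
listSum-*ˡ r (a ∷ as) f =
  trans (cong (r * f a +_) (listSum-*ˡ r as f)) (sym (ℚP.*-distribˡ-+ r (f a) (listSum as f)))

listSum-filter : ∀ {A : Set} {P : A → Set} (P? : ∀ a → Dec (P a)) as f →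
  listSum (filter P? as) f ≡ listSum as (λ a → (if does (P? a) then 1ℚ else 0ℚ) * f a)
listSum-filter P? []       f = refl
listSum-filter P? (a ∷ as) f with does (P? a)
... | true  = cong₂ _+_ (sym (ℚP.*-identityˡ (f a))) (listSum-filter P? as f)
... | false = trans (listSum-filter P? as f)
  (sym (trans (cong (_+ rest) (ℚP.*-zeroˡ (f a))) (ℚP.+-identityˡ rest)))
  where
  rest : ℚ
  rest = listSum as (λ a → (if does (P? a) then 1ℚ else 0ℚ) * f a)

listSum-applyUpTo : ∀ n f → listSum (applyUpTo suc n) f ≡ ∑ n f
listSum-applyUpTo zero    f = refl
listSum-applyUpTo (suc n) f = begin
  listSum (applyUpTo suc (suc n)) f                ≡⟨ cong (λ as → listSum as f) (sym (ListP.applyUpTo-∷ʳ suc n)) ⟩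
  listSum (applyUpTo suc n ++ [ suc n ]) f         ≡⟨ listSum-++ (applyUpTo suc n) [ suc n ] f ⟩
  listSum (applyUpTo suc n) f + (f (suc n) + 0ℚ)   ≡⟨ cong₂ _+_ (listSum-applyUpTo n f) (ℚP.+-identityʳ (f (suc n))) ⟩
  ∑ (suc n) f                                      ∎

ends : List ℕ → ℕ × ℕ
ends ns = hd ns , lst ns

indicator-∧ : ∀ a b → (if a ∧ b then 1ℚ else 0ℚ) ≡ (if a then 1ℚ else 0ℚ) * (if b then 1ℚ else 0ℚ)
indicator-∧ true  b = sym (ℚP.*-identityˡ (if b then 1ℚ else 0ℚ))
indicator-∧ false b = sym (ℚP.*-zeroˡ (if b then 1ℚ else 0ℚ))

indicator-path : ∀ ns nss ns₀ →
  (if andAll (zipWith (λ a b → hd a ≤ᵇ lst b) (ns ∷ nss) (nss ++ [ ns₀ ])) then 1ℚ else 0ℚ)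
    ≡ path (hd ns) (map ends nss) (lst ns₀)
indicator-path ns []         ns₀ =
  trans (indicator-∧ (hd ns ≤ᵇ lst ns₀) true) (ℚP.*-identityʳ (le (hd ns) (lst ns₀)))
indicator-path ns (ms ∷ nss) ns₀ =
  trans (indicator-∧ (hd ns ≤ᵇ lst ms) _) (cong (le (hd ns) (lst ms) *_) (indicator-path ms nss ns₀))

indicator-cycOK : ∀ nss → (if does (cycOK nss Bool.≟ true) then 1ℚ else 0ℚ) ≡ cyclic (map ends nss)
indicator-cycOK nss = trans (does-≟-true (cycOK nss)) (go nss)
  where
  does-≟-true : ∀ b → (if does (b Bool.≟ true) then 1ℚ else 0ℚ) ≡ (if b then 1ℚ else 0ℚ)
  does-≟-true true  = refl
  does-≟-true false = refl
  go : ∀ nss → (if cycOK nss then 1ℚ else 0ℚ) ≡ cyclic (map ends nss)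
  go []         = refl
  go (ns ∷ nss) = indicator-path ns nss ns

-- The cyclic sums over lists of tuples as nested functionals

module _ (N : ℕ) where

  monomials : List ℕ → List ℕ → ℚ
  monomials ks ns = prodQ (zipWith (λ k n → powQ (invN n) k) ks ns)

  incSeqs-suc : ∀ r n f → listSum (incSeqs (suc N) (suc r) (suc n)) f
    ≡ ∑ N (λ m → lt n m * listSum (incSeqs (suc N) r (suc m)) (λ ns → f (m ∷ ns)))
  incSeqs-suc r n f = begin
    listSum (concatMap (λ m → map (m ∷_) (incSeqs (suc N) r (suc m))) (filter (suc n ℕ.≤?_) (applyUpTo suc N))) f
      ≡⟨ listSum-concatMap (λ m → map (m ∷_) (incSeqs (suc N) r (suc m))) (filter (suc n ℕ.≤?_) (applyUpTo suc N)) f ⟩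
    listSum (filter (suc n ℕ.≤?_) (applyUpTo suc N)) (λ m → listSum (map (m ∷_) (incSeqs (suc N) r (suc m))) f)
      ≡⟨ listSum-cong (filter (suc n ℕ.≤?_) (applyUpTo suc N)) (λ m → listSum-map (m ∷_) (incSeqs (suc N) r (suc m)) f) ⟩
    listSum (filter (suc n ℕ.≤?_) (applyUpTo suc N)) inner
      -- The decision of suc n ≤ m computes to `n <ᵇ m`, so the indicator of the filter is `lt n m`.
      ≡⟨ listSum-filter (suc n ℕ.≤?_) (applyUpTo suc N) inner ⟩
    listSum (applyUpTo suc N) (λ m → lt n m * inner m)
      ≡⟨ listSum-applyUpTo N (λ m → lt n m * inner m) ⟩
    ∑ N (λ m → lt n m * inner m) ∎
    where
    inner : ℕ → ℚ
    inner m = listSum (incSeqs (suc N) r (suc m)) (λ ns → f (m ∷ ns))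

  incSeqs-head : ∀ k ks (f : List ℕ → ℚ) m →
    listSum (incSeqs (suc N) (length ks) (suc m)) (λ ns → monomials (k ∷ ks) (m ∷ ns) * f ns)
      ≡ powQ (invN m) k * listSum (incSeqs (suc N) (length ks) (suc m)) (λ ns → monomials ks ns * f ns)
  incSeqs-head k ks f m = trans
    (listSum-cong (incSeqs (suc N) (length ks) (suc m)) (λ ns → ℚP.*-assoc (powQ (invN m) k) (monomials ks ns) (f ns)))
    (listSum-*ˡ (powQ (invN m) k) (incSeqs (suc N) (length ks) (suc m)) (λ ns → monomials ks ns * f ns))

  -- Taking `lst (n ∷ ns)` makes the empty sequence hand n to ψ, in agreement with `chain`.
  incSeqs-chain : ∀ ks n ψ →
    listSum (incSeqs (suc N) (length ks) (suc n)) (λ ns → monomials ks ns * ψ (lst (n ∷ ns))) ≡ chain N n ks ψ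
  incSeqs-chain []       n ψ = trans (ℚP.+-identityʳ (1ℚ * ψ n)) (ℚP.*-identityˡ (ψ n))
  incSeqs-chain (k ∷ ks) n ψ = trans
    (incSeqs-suc (length ks) n (λ ns → monomials (k ∷ ks) ns * ψ (lst (n ∷ ns))))
    (∑-linear N .ext (λ m → trans
      (cong (lt n m *_) (trans (incSeqs-head k ks (λ ns → ψ (lst (m ∷ ns))) m)
                               (cong (powQ (invN m) k *_) (incSeqs-chain ks m ψ))))
      (swap (lt n m) (powQ (invN m) k) (chain N m ks ψ))))
    where
    swap : ∀ a b c → a * (b * c) ≡ b * (a * c)
    swap = solve-∀ ℚ-ring

  incSeqs-slot : ∀ ks φ →
    listSum (incSeqs (suc N) (length ks) 1) (λ ns → monomials ks ns * φ (ends ns)) ≡ slot N ks φ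
  incSeqs-slot []       φ = trans (ℚP.+-identityʳ (1ℚ * φ (0 , 0))) (ℚP.*-identityˡ (φ (0 , 0)))
  incSeqs-slot (k ∷ ks) φ = trans
    (incSeqs-suc (length ks) 0 (λ ns → monomials (k ∷ ks) ns * φ (ends ns)))
    (∑-cong N (λ m 1≤m _ → trans
      -- The lower bound 1 is `suc 0`, so the indicator `lt 0 m` is always 1 here.
      (*-identityˡ-≡ (listSum (incSeqs (suc N) (length ks) (suc m)) (λ ns → monomials (k ∷ ks) (m ∷ ns) * φ (ends (m ∷ ns)))) (lt-yes 1≤m))
      (trans (incSeqs-head k ks (λ ns → φ (m , lst (m ∷ ns))) m)
             (cong (powQ (invN m) k *_) (incSeqs-chain ks m (λ b → φ (m , b)))))))

  allTuples-tuples : ∀ kss F →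
    listSum (allTuples (suc N) (map length kss)) (λ nss → weight kss nss * F (map ends nss)) ≡ tuples N kss F
  allTuples-tuples []         F = trans (ℚP.+-identityʳ (1ℚ * F [])) (ℚP.*-identityˡ (F []))
  allTuples-tuples (ks ∷ kss) F = begin
    listSum (concatMap (λ ns → map (ns ∷_) T) (incSeqs (suc N) (length ks) 1)) f
      ≡⟨ listSum-concatMap (λ ns → map (ns ∷_) T) (incSeqs (suc N) (length ks) 1) f ⟩
    listSum (incSeqs (suc N) (length ks) 1) (λ ns → listSum (map (ns ∷_) T) f)
      ≡⟨ listSum-cong (incSeqs (suc N) (length ks) 1) inner ⟩
    listSum (incSeqs (suc N) (length ks) 1) (λ ns → monomials ks ns * tuples N kss (λ ps → F (ends ns ∷ ps)))
      ≡⟨ incSeqs-slot ks (λ ab → tuples N kss (λ ps → F (ab ∷ ps))) ⟩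
    tuples N (ks ∷ kss) F ∎
    where
    T : List (List (List ℕ))
    T = allTuples (suc N) (map length kss)
    f : List (List ℕ) → ℚ
    f nss = weight (ks ∷ kss) nss * F (map ends nss)
    inner : ∀ ns → listSum (map (ns ∷_) T) f ≡ monomials ks ns * tuples N kss (λ ps → F (ends ns ∷ ps))
    inner ns = begin
      listSum (map (ns ∷_) T) f
        ≡⟨ listSum-map (ns ∷_) T f ⟩
      listSum T (λ nss → monomials ks ns * weight kss nss * F (ends ns ∷ map ends nss))
        ≡⟨ listSum-cong T (λ nss → ℚP.*-assoc (monomials ks ns) (weight kss nss) (F (ends ns ∷ map ends nss))) ⟩
      listSum T (λ nss → monomials ks ns * (weight kss nss * F (ends ns ∷ map ends nss)))
        ≡⟨ listSum-*ˡ (monomials ks ns) T (λ nss → weight kss nss * F (ends ns ∷ map ends nss)) ⟩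
      monomials ks ns * listSum T (λ nss → weight kss nss * F (ends ns ∷ map ends nss))
        ≡⟨ cong (monomials ks ns *_) (allTuples-tuples kss (λ ps → F (ends ns ∷ ps))) ⟩
      monomials ks ns * tuples N kss (λ ps → F (ends ns ∷ ps)) ∎

  zetaCycP-tuples : ∀ kss → zetaCycP (suc N) kss ≡ tuples N kss cyclic
  zetaCycP-tuples kss = begin
    listSum (filter (λ nss → cycOK nss Bool.≟ true) T) (weight kss)
      ≡⟨ listSum-filter (λ nss → cycOK nss Bool.≟ true) T (weight kss) ⟩
    listSum T (λ nss → (if does (cycOK nss Bool.≟ true) then 1ℚ else 0ℚ) * weight kss nss)
      ≡⟨ listSum-cong T (λ nss → trans (cong (_* weight kss nss) (indicator-cycOK nss))
                                       (ℚP.*-comm (cyclic (map ends nss)) (weight kss nss))) ⟩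
    listSum T (λ nss → weight kss nss * cyclic (map ends nss))
      ≡⟨ allTuples-tuples kss cyclic ⟩
    tuples N kss cyclic ∎
    where
    T : List (List (List ℕ))
    T = allTuples (suc N) (map length kss)

-- Words and indices

replicate-++-[] : ∀ {A : Set} n (a : A) → replicate n a ++ [ a ] ≡ a ∷ replicate n a
replicate-++-[] zero    a = refl
replicate-++-[] (suc n) a = cong (a ∷_) (replicate-++-[] n a)

reverse-replicate : ∀ {A : Set} n (a : A) → reverse (replicate n a) ≡ replicate n a
reverse-replicate zero    a = refl
reverse-replicate (suc n) a = begin
  reverse (a ∷ replicate n a)       ≡⟨ ListP.unfold-reverse a (replicate n a) ⟩
  reverse (replicate n a) ++ [ a ]  ≡⟨ cong (_++ [ a ]) (reverse-replicate n a) ⟩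
  replicate n a ++ [ a ]            ≡⟨ replicate-++-[] n a ⟩
  a ∷ replicate n a                 ∎

shuffleF-y : ∀ m → shuffleF [ y ] (replicate m x)
                 ≡ map (λ (a , b) → replicate a x ++ y ∷ replicate b x) (splits m)
shuffleF-y zero    = refl
shuffleF-y (suc m) = cong ((y ∷ replicate (suc m) x) ∷_) (begin
  map (x ∷_) (shuffleF [ y ] (replicate m x))
    ≡⟨ cong (map (x ∷_)) (shuffleF-y m) ⟩
  map (x ∷_) (map (λ (a , b) → replicate a x ++ y ∷ replicate b x) (splits m))
    ≡⟨ trans (sym (ListP.map-∘ (splits m))) (ListP.map-∘ (splits m)) ⟩
  map (λ (a , b) → replicate a x ++ y ∷ replicate b x) (map (λ (a , b) → suc a , b) (splits m)) ∎)

zs-pair : ℕ × ℕ → Word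
zs-pair (i , j) = zs (i ∷ j ∷ [])

-- Reversal turns x^a y x^b into x^b y x^a; hence the exchanged order of a and b in `ytildePairs`.
yx-reverse-x : ∀ a b → y ∷ x ∷ (reverse (replicate a x ++ y ∷ replicate b x) ++ [ x ])
                     ≡ zs-pair (2 ℕ.+ b , 2 ℕ.+ a)
yx-reverse-x a b = cong (λ w → y ∷ x ∷ w) (begin
  reverse (replicate a x ++ y ∷ replicate b x) ++ [ x ]
    ≡⟨ cong (_++ [ x ]) (ListP.reverse-++ (replicate a x) (y ∷ replicate b x)) ⟩
  (reverse (y ∷ replicate b x) ++ reverse (replicate a x)) ++ [ x ]
    ≡⟨ cong₂ (λ u v → (u ++ v) ++ [ x ])
         (trans (ListP.unfold-reverse y (replicate b x)) (cong (_++ [ y ]) (reverse-replicate b x)))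
         (reverse-replicate a x) ⟩
  ((replicate b x ++ [ y ]) ++ replicate a x) ++ [ x ]
    ≡⟨ ListP.++-assoc (replicate b x ++ [ y ]) (replicate a x) [ x ] ⟩
  (replicate b x ++ [ y ]) ++ (replicate a x ++ [ x ])
    ≡⟨ ListP.++-assoc (replicate b x) [ y ] (replicate a x ++ [ x ]) ⟩
  replicate b x ++ y ∷ (replicate a x ++ [ x ])
    ≡⟨ cong (λ w → replicate b x ++ y ∷ w) (trans (replicate-++-[] a x) (sym (ListP.++-identityʳ (x ∷ replicate a x)))) ⟩
  replicate b x ++ y ∷ x ∷ (replicate a x ++ []) ∎)

ytildeZ-pairs : ∀ k → ytildeZ k ≡ map (λ (c , p) → c , zs-pair p) (ytildePairs k)
ytildeZ-pairs zero                = refl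
ytildeZ-pairs (suc zero)          = refl
ytildeZ-pairs (suc (suc zero))    = refl
ytildeZ-pairs (suc (suc (suc m))) = begin
  map insert (map reverse (shuffleF [ y ] (reverse (replicate m x))))
    ≡⟨ cong (λ w → map insert (map reverse (shuffleF [ y ] w))) (reverse-replicate m x) ⟩
  map insert (map reverse (shuffleF [ y ] (replicate m x)))
    ≡⟨ cong (λ ws → map insert (map reverse ws)) (shuffleF-y m) ⟩
  map insert (map reverse (map (λ (a , b) → replicate a x ++ y ∷ replicate b x) (splits m)))
    ≡⟨ trans (cong (map insert) (sym (ListP.map-∘ (splits m)))) (sym (ListP.map-∘ (splits m))) ⟩
  map (λ (a , b) → insert (reverse (replicate a x ++ y ∷ replicate b x))) (splits m)
    ≡⟨ ListP.map-cong (λ (a , b) → cong (1ℚ ,_) (yx-reverse-x a b)) (splits m) ⟩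
  map (λ (a , b) → 1ℚ , zs-pair (2 ℕ.+ b , 2 ℕ.+ a)) (splits m)
    ≡⟨ ListP.map-∘ (splits m) ⟩
  map (λ (c , p) → c , zs-pair p) (ytildePairs (3 ℕ.+ m)) ∎
  where
  insert : Word → ℚ × Word
  insert w = 1ℚ , y ∷ x ∷ (w ++ [ x ])

ytilde-zs : ∀ ks Φ → ⟪ ytilde ks ⟫ Φ ≡ ⟪ ytildeIndices ks ⟫ (Φ ∘ zs)
ytilde-zs []       Φ = refl
ytilde-zs (k ∷ ks) Φ = begin
  ⟪ ytilde (k ∷ ks) ⟫ Φ
    ≡⟨ ⟪⟫-++ (map (λ (c , u) → c , u ++ zs ks) (ytildeZ k)) (map (λ (c , u) → c , z k ++ u) (ytilde ks)) Φ ⟩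
  ⟪ map (λ (c , u) → c , u ++ zs ks) (ytildeZ k) ⟫ Φ + ⟪ map (λ (c , u) → c , z k ++ u) (ytilde ks) ⟫ Φ
    ≡⟨ cong₂ _+_ (⟪⟫-map (_++ zs ks) (ytildeZ k) Φ)
         (trans (⟪⟫-map (z k ++_) (ytilde ks) Φ) (ytilde-zs ks (λ u → Φ (z k ++ u)))) ⟩
  ⟪ ytildeZ k ⟫ (λ u → Φ (u ++ zs ks)) + ⟪ ytildeIndices ks ⟫ (λ u → Φ (zs (k ∷ u)))
    ≡⟨ cong (_+ ⟪ ytildeIndices ks ⟫ (λ u → Φ (zs (k ∷ u)))) head ⟩
  ⟪ ytildePairs k ⟫ (λ p → Φ (zs (proj₁ p ∷ proj₂ p ∷ ks))) + ⟪ ytildeIndices ks ⟫ (λ u → Φ (zs (k ∷ u)))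
    ≡⟨ sym (ytildeIndices-∷ k ks (Φ ∘ zs)) ⟩
  ⟪ ytildeIndices (k ∷ ks) ⟫ (Φ ∘ zs) ∎
  where
  head : ⟪ ytildeZ k ⟫ (λ u → Φ (u ++ zs ks)) ≡ ⟪ ytildePairs k ⟫ (λ p → Φ (zs (proj₁ p ∷ proj₂ p ∷ ks)))
  head = begin
    ⟪ ytildeZ k ⟫ (λ u → Φ (u ++ zs ks))
      ≡⟨ cong (λ L → ⟪ L ⟫ (λ u → Φ (u ++ zs ks))) (ytildeZ-pairs k) ⟩
    ⟪ map (λ (c , p) → c , zs-pair p) (ytildePairs k) ⟫ (λ u → Φ (u ++ zs ks))
      ≡⟨ ⟪⟫-map zs-pair (ytildePairs k) (λ u → Φ (u ++ zs ks)) ⟩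
    ⟪ ytildePairs k ⟫ (λ p → Φ (zs-pair p ++ zs ks))
      ≡⟨ ⟪⟫-linear (ytildePairs k) .ext (λ (i , j) → cong Φ (sym (ListP.concatMap-++ z (i ∷ j ∷ []) ks))) ⟩
    ⟪ ytildePairs k ⟫ (λ p → Φ (zs (proj₁ p ∷ proj₂ p ∷ ks))) ∎

incAll-zs : ∀ ks Φ → ⟪ incAll ks ⟫ Φ ≡ ⟪ incIndices ks ⟫ (Φ ∘ zs)
incAll-zs []       Φ = refl
incAll-zs (k ∷ ks) Φ = cong (1ℚ * Φ (zs (suc k ∷ ks)) +_) (trans
  (⟪⟫-map (z k ++_) (incAll ks) Φ)
  (trans (incAll-zs ks (λ u → Φ (z k ++ u))) (sym (⟪⟫-map (k ∷_) (incIndices ks) (Φ ∘ zs)))))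

-- Since `z 0` and `z 1` are the same word, `parse` inverts `zs` only on lists with positive
-- entries.
Positive : List ℕ → Set
Positive = All (1 ≤_)

parseGo-replicate : ∀ j a w → parseGo j (replicate a x ++ w) ≡ parseGo (a ℕ.+ j) w
parseGo-replicate j zero    w = refl
parseGo-replicate j (suc a) w = trans (parseGo-replicate (suc j) a w) (cong (λ i → parseGo i w) (ℕP.+-suc a j))

parseGo-zs : ∀ j ks → Positive ks → parseGo j (zs ks) ≡ j ∷ ks
parseGo-zs j []       []            = refl
parseGo-zs j (k ∷ ks) (1≤k ∷ ks≥1) = cong (j ∷_) (begin
  parseGo 1 (replicate (k ∸ 1) x ++ zs ks)  ≡⟨ parseGo-replicate 1 (k ∸ 1) (zs ks) ⟩
  parseGo (k ∸ 1 ℕ.+ 1) (zs ks)             ≡⟨ cong (λ i → parseGo i (zs ks)) (ℕP.m∸n+n≡m 1≤k) ⟩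
  parseGo k (zs ks)                         ≡⟨ parseGo-zs k ks ks≥1 ⟩
  k ∷ ks                                    ∎)

parse-zs : ∀ ks → Positive ks → parse (zs ks) ≡ ks
parse-zs []       _    = refl
-- The leading y closes a dummy run of length 0; the tail of that result is the parse.
parse-zs (k ∷ ks) ks≥1 = ListP.∷-injectiveʳ (parseGo-zs 0 (k ∷ ks) ks≥1)

ytildePairs-positive : ∀ k → All (λ (c , i , j) → 1 ≤ i × 1 ≤ j) (ytildePairs k)
ytildePairs-positive zero                = []
ytildePairs-positive (suc zero)          = (s≤s z≤n , s≤s z≤n) ∷ []
ytildePairs-positive (suc (suc zero))    = []
ytildePairs-positive (suc (suc (suc m))) = AllP.map⁺ (All.universal (λ _ → s≤s z≤n , s≤s z≤n) (splits m))

ytildeIndices-positive : ∀ ks → Positive ks → All (Positive ∘ proj₂) (ytildeIndices ks)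
ytildeIndices-positive []       []           = []
ytildeIndices-positive (k ∷ ks) (1≤k ∷ ks≥1) = AllP.++⁺
  (AllP.map⁺ (All.map (λ (1≤i , 1≤j) → 1≤i ∷ 1≤j ∷ ks≥1) (ytildePairs-positive k)))
  (AllP.map⁺ (All.map (1≤k ∷_) (ytildeIndices-positive ks ks≥1)))

incIndices-positive : ∀ ks → Positive ks → All (Positive ∘ proj₂) (incIndices ks)
incIndices-positive []       []           = []
incIndices-positive (k ∷ ks) (1≤k ∷ ks≥1) =
  (s≤s z≤n ∷ ks≥1) ∷ AllP.map⁺ (All.map (1≤k ∷_) (incIndices-positive ks ks≥1))

⟪⟫-parse-zs : ∀ L Φ → All (Positive ∘ proj₂) L → ⟪ L ⟫ (Φ ∘ parse ∘ zs) ≡ ⟪ L ⟫ Φ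
⟪⟫-parse-zs []            Φ []            = refl
⟪⟫-parse-zs ((c , u) ∷ L) Φ (u≥1 ∷ L≥1) =
  cong₂ (λ v r → c * Φ v + r) (parse-zs u u≥1) (⟪⟫-parse-zs L Φ L≥1)

map-parse-zs : ∀ kss → All Positive kss → map parse (map zs kss) ≡ kss
map-parse-zs []         []            = refl
map-parse-zs (ks ∷ kss) (p ∷ kss≥1) = cong₂ _∷_ (parse-zs ks p) (map-parse-zs kss kss≥1)

-- The tensors are evaluated only after `parse`, so words can be exchanged for index lists one slot
-- at a time, provided the test function stays arbitrary.
sumSlots-slotwise : ∀ (f : List ℕ → Lin Word) (g : List ℕ → Lin (List ℕ)) →
  (∀ ks → Positive ks → ∀ Φ → ⟪ f ks ⟫ (Φ ∘ parse) ≡ ⟪ g ks ⟫ Φ) →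
  ∀ kss → All Positive kss → ∀ Φ → ⟪ sumSlots f kss ⟫ (Φ ∘ map parse) ≡ ⟪ slotwise g kss ⟫ Φ
sumSlots-slotwise f g f≈g []         []            Φ = refl
sumSlots-slotwise f g f≈g (ks ∷ kss) (p ∷ kss≥1) Φ = begin
  ⟪ sumSlots f (ks ∷ kss) ⟫ (Φ ∘ map parse)
    ≡⟨ ⟪⟫-++ (map (λ (c , u) → c , u ∷ map zs kss) (f ks)) (map (λ (c , t) → c , zs ks ∷ t) (sumSlots f kss)) (Φ ∘ map parse) ⟩
  ⟪ map (λ (c , u) → c , u ∷ map zs kss) (f ks) ⟫ (Φ ∘ map parse)
    + ⟪ map (λ (c , t) → c , zs ks ∷ t) (sumSlots f kss) ⟫ (Φ ∘ map parse)
    ≡⟨ cong₂ _+_ (⟪⟫-map (_∷ map zs kss) (f ks) (Φ ∘ map parse)) (⟪⟫-map (zs ks ∷_) (sumSlots f kss) (Φ ∘ map parse)) ⟩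
  ⟪ f ks ⟫ (λ u → Φ (parse u ∷ map parse (map zs kss)))
    + ⟪ sumSlots f kss ⟫ (λ t → Φ (parse (zs ks) ∷ map parse t))
    ≡⟨ cong₂ _+_
         (trans (cong (λ t → ⟪ f ks ⟫ (λ u → Φ (parse u ∷ t))) (map-parse-zs kss kss≥1))
                (f≈g ks p (λ u → Φ (u ∷ kss))))
         (trans (cong (λ u → ⟪ sumSlots f kss ⟫ (λ t → Φ (u ∷ map parse t))) (parse-zs ks p))
                (sumSlots-slotwise f g f≈g kss kss≥1 (λ t → Φ (ks ∷ t)))) ⟩
  ⟪ g ks ⟫ (λ u → Φ (u ∷ kss)) + ⟪ slotwise g kss ⟫ (λ t → Φ (ks ∷ t))
    ≡⟨ sym (slotwise-∷ g ks kss Φ) ⟩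
  ⟪ slotwise g (ks ∷ kss) ⟫ Φ ∎

ZcycP-tuples : ∀ N (f : List ℕ → Lin Word) (g : List ℕ → Lin (List ℕ)) →
  (∀ ks Φ → ⟪ f ks ⟫ Φ ≡ ⟪ g ks ⟫ (Φ ∘ zs)) →
  (∀ ks → Positive ks → All (Positive ∘ proj₂) (g ks)) →
  ∀ kss → All Positive kss →
  ZcycP (suc N) (sumSlots f kss) ≡ ⟪ slotwise g kss ⟫ (λ t → tuples N t cyclic)
ZcycP-tuples N f g f-zs g≥1 kss kss≥1 = trans
  (sumSlots-slotwise f g
    (λ ks p Φ → trans (f-zs ks (Φ ∘ parse)) (⟪⟫-parse-zs (g ks) Φ (g≥1 ks p)))
    kss kss≥1 (zetaCycP (suc N)))
  (⟪⟫-linear (slotwise g kss) .ext (zetaCycP-tuples N))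

-- The congruence

mainTheorem1 : (kss : List (List ℕ)) → kss ≢ [] → All (λ ks → ks ≢ []) kss → All (All (1 ≤_)) kss →
    (λ p → ZcycP p (sumSlots ytilde kss)) ≡𝒜 (λ p → (1ℚ + 1ℚ) * ZcycP p (sumSlots incAll kss))
-- No prime has to be excluded, so the threshold is 0.
mainTheorem1 kss kss≢[] kss≢ kss≥1 = 0 , congruence
  where
  cancel : ∀ a b → a + b - a ≡ b
  cancel = solve-∀ ℚ-ring

  -- The doubled sums cancel exactly in ℚ, before any reduction modulo p.
  difference : ∀ N → ZcycP (suc N) (sumSlots ytilde kss) - 2ℚ * ZcycP (suc N) (sumSlots incAll kss)
                   ≡ tuples N kss (moveAny N cyclic)
  difference N = begin
    ZcycP (suc N) (sumSlots ytilde kss) - 2ℚ * ZcycP (suc N) (sumSlots incAll kss)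
      ≡⟨ cong₂ (λ q r → q - 2ℚ * r)
           (trans (ZcycP-tuples N ytilde ytildeIndices ytilde-zs ytildeIndices-positive kss kss≥1)
                  (tuples-ytilde N kss cyclic kss≢ kss≥1))
           (ZcycP-tuples N incAll incIndices incAll-zs incIndices-positive kss kss≥1) ⟩
    2ℚ * I + T - 2ℚ * I
      ≡⟨ cancel (2ℚ * I) T ⟩
    T ∎
    where
    I T : ℚ
    I = ⟪ slotwise incIndices kss ⟫ (λ t → tuples N t cyclic)
    T = tuples N kss (moveAny N cyclic)

  congruence : ∀ p → Prime p → 0 < p →
    p ∣ ℤ.∣ ↥ (ZcycP p (sumSlots ytilde kss) - 2ℚ * ZcycP p (sumSlots incAll kss)) ∣
  congruence (suc N) p-prime _ = multiple⇒∣ (subst (Multiple (ℤ.+ suc N)) (sym (difference N))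
    (CyclicSum.multiple-cyclic p-prime kss kss≢[] kss≢))
    where open Localization p-prime
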